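{- Let $q$ be an odd prime power with $q\equiv 0,\pm1\pmod 5$, and let $b$ satisfy $b^2+b=1$ (so $b\in\mathbb{F}_q$). Let $g(x)=x^q+x^{q^3}+bx^{q^5}\in\mathbb{F}_{q^6}[x]$. Then $U_g=\{(x,g(x)) : x\in\mathbb{F}_{q^6}\}$ is a maximum scattered $\mathbb{F}_q$-subspace of $\mathbb{F}_{q^6}^2$.
   Context: An $\mathbb{F}_q$-subspace $U$ of $\mathbb{F}_{q^n}^2$ of $\mathbb{F}_q$-dimension $n$ is maximum scattered if the linear set $L_U=\{\langle u\rangle_{\mathbb{F}_{q^n}} : u\in U\setminus\{0\}\}\subseteq\mathrm{PG}(1,q^n)$ has size $(q^n-1)/(q-1)$, equivalently $\dim_{\mathbb{F}_q}(U\cap\langle v\rangle_{\mathbb{F}_{q^n}})\le 1$ for every nonzero $v\in\mathbb{F}_{q^n}^2$. -}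

module Defs where

open import Level using (Level; suc; _⊔_)
open import Data.Nat as ℕ using (ℕ; zero; suc)
open import Data.Fin using (Fin)
import Data.Fin
open import Data.Product using (Σ; ∃; ∃-syntax; _×_; _,_)
open import Data.Sum using (_⊎_)
open import Data.Nat.Primality using (Prime)
open import Algebra.Core using (Op₁; Op₂)
open import Algebra.Structures using (IsCommutativeRing)
open import Function.Bundles using (_↔_)
open import Relation.Binary.PropositionalEquality using (_≡_; _≢_)
open import Relation.Nullary using (¬_)

IsPrimePower : ℕ → Set
IsPrimePower q = ∃[ p ] ∃[ k ] (Prime p × 1 ℕ.≤ k × q ≡ p ℕ.^ k)

record FiniteField (N : ℕ) : Set₁ where
  infixl 6 _+_
  infixl 7 _*_
  field
    Carrier : Set
    _+_ _*_ : Op₂ Carrier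
    -_      : Op₁ Carrier
    0# 1#   : Carrier
    isCommutativeRing : IsCommutativeRing _≡_ _+_ _*_ -_ 0# 1#
    1≢0     : 1# ≢ 0#
    inverse : ∀ x → x ≢ 0# → ∃[ y ] (x * y ≡ 1#)
    enumeration : Carrier ↔ Fin N

  _^_ : Carrier → ℕ → Carrier
  x ^ zero  = 1#
  x ^ suc n = x * (x ^ n)

module FieldExtension {N : ℕ} (K : FiniteField N) (q : ℕ) where
  open FiniteField K

  InFq : Carrier → Set
  InFq a = a ^ q ≡ a

  V : Set
  V = Carrier × Carrier

  0V : V
  0V = 0# , 0#

  _⊕_ : V → V → V
  (x₁ , y₁) ⊕ (x₂ , y₂) = (x₁ + x₂) , (y₁ + y₂)

  _·_ : Carrier → V → V
  a · (x , y) = (a * x) , (a * y)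

  lincomb : (n : ℕ) → (Fin n → Carrier) → (Fin n → V) → V
  lincomb zero    a e = 0V
  lincomb (suc n) a e = (a Data.Fin.zero · e Data.Fin.zero) ⊕ lincomb n (λ i → a (Data.Fin.suc i)) (λ i → e (Data.Fin.suc i))

  IsFqSubspace : (V → Set) → Set
  IsFqSubspace U = U 0V
                 × (∀ u w → U u → U w → U (u ⊕ w))
                 × (∀ a u → InFq a → U u → U (a · u))

  HasFqDim : (V → Set) → ℕ → Set
  HasFqDim U n = ∃[ e ] ((∀ i → U (e i))
               × (∀ u → U u → ∃[ a ] ((∀ i → InFq (a i)) × u ≡ lincomb n a e))
               × (∀ a → (∀ i → InFq (a i)) → lincomb n a e ≡ 0V → ∀ i → a i ≡ 0#))

  InSpan : V → V → Set
  InSpan v u = ∃[ λ' ] (u ≡ λ' · v)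

  -- dim_{F_q}(U ∩ ⟨v⟩) ≤ 1 for all nonzero v: any two vectors of U ∩ ⟨v⟩
  -- are F_q-linearly dependent
  IsScattered : (V → Set) → Set
  IsScattered U = ∀ v → v ≢ 0V → ∀ u₁ u₂ → U u₁ → InSpan v u₁ → U u₂ → InSpan v u₂ →
    ∃[ a ] ∃[ c ] (InFq a × InFq c × ¬ (a ≡ 0# × c ≡ 0#) × (a · u₁) ⊕ (c · u₂) ≡ 0V)

  -- maximum scattered F_q-subspace of K² where K = F_{q^n}
  IsMaxScattered : ℕ → (V → Set) → Set
  IsMaxScattered n U = IsFqSubspace U × HasFqDim U n × IsScattered U

  graph : (Carrier → Carrier) → V → Set
  graph f u = ∃[ x ] (u ≡ (x , f x))

{-# OPTIONS --safe #-}

-- The graph of f is scattered iff the kernel of f - m has dimension at most 1 over F_q for every m.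
-- Write m_i and x_i for the conjugates under x ↦ x^q. The six conjugates of f x = m x couple
-- (x₀, x₂, x₄) and (x₁, x₃, x₅) through circulant matrices which b² + b = 1 makes easy to invert.
-- Eliminating the odd half gives linear equations in (x₀, x₂, x₄) whose coefficients involve only
-- the products m_i m_(i+1) and m_i m_(i+3). If the kernel has dimension at least 2, the 2 × 2 minors
-- vanish: one of them and its conjugate force (2 being invertible) m₀ m₁ = m₃ m₄, then
-- m_i m_(i+3) = 1 - b and m_i m_(i+1) = 1 - b for all i, which contradicts another minor.
--
-- b lies in F_q because it is -3 in characteristic 5 and otherwise ζ + ζ⁻¹ for a fifth root of unity ζ
-- in K. The graph has dimension 6 because x^q - x has exactly q roots: it divides x^(q^6) - x,
-- and the cofactor has at most q^6 - q roots.
module Submission where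

open import Defs
open import Algebra.Bundles using (CommutativeRing; CommutativeSemiring)
open import Data.Empty using (⊥; ⊥-elim)
open import Data.Fin.Base as Fin using (Fin; punchIn; finToFun; funToFin)
open import Data.Fin.Permutation using (Permutation′; permutation)
import Data.Fin.Properties as Fin
open import Data.Integer.Base as ℤ using (ℤ; 0ℤ; 1ℤ)
import Data.Integer.Properties as ℤ
open import Data.Maybe.Base as Maybe using (Maybe)
open import Data.Nat.Base as ℕ using (ℕ; zero; suc; _∸_; _!; s≤s; z≤n)
open import Data.Nat.Combinatorics using (_C_; nCn≡1; nCk≡n!/k![n-k]!; k![n∸k]!∣n!)
open import Data.Nat.Divisibility using (_∣_; divides; ∣⇒≤; m∣m*n; m%n≡0⇒n∣m)
open import Data.Nat.DivMod using (_%_; _/_; m/n*n≡m; m≡m%n+[m/n]*n; %-distribˡ-*)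
open import Data.Nat.Primality using (Prime; prime?; euclidsLemma; prime⇒nonTrivial; prime⇒irreducible)
import Data.Nat.Properties as ℕ
open import Data.Nat.Solver using (module +-*-Solver)
open import Data.Product.Base using (∃; ∃₂; _×_; _,_; proj₁; proj₂)
open import Data.Sum.Base using (_⊎_; inj₁; inj₂; [_,_]′)
open import Data.Vec.Functional using (removeAt; _∷_)
open import Function.Base using (_∘_; _$_; id)
open import Function.Bundles using (Inverse)
open import Function.Definitions using (Injective)
open import Level using (0ℓ)
open import Relation.Binary.Definitions using (DecidableEquality)
open import Relation.Binary.PropositionalEquality as ≡ using (_≡_; _≢_)
open import Relation.Nullary using (¬_; Dec; contradiction; yes; no)
open import Relation.Nullary.Decidable using (dec⇒maybe; from-yes; map′)
open import Relation.Unary using (Decidable)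

-- Ring identities over an abstract commutative ring.

-- Integer coefficients let the ring solver cancel x - x over an abstract ring.
module IntegerCoefficients (R : CommutativeRing 0ℓ 0ℓ) where
  open CommutativeRing R
  open import Data.Integer.Base using (+_; -[1+_]; _⊖_)
  open import Algebra.Properties.Ring ring using (-0#≈0#; -‿+-comm; -‿involutive; -‿distribˡ-*; -‿distribʳ-*)
  open import Algebra.Properties.Semiring.Mult.TCOptimised semiring using (1+×; ×-homo-+; ×1-homo-*) renaming (_×_ to _×ℕ_)
  open import Algebra.Solver.Ring.AlmostCommutativeRing
    using (fromCommutativeRing; _-Raw-AlmostCommutative⟶_)
  open import Relation.Binary.Reasoning.Setoid setoid

  ⟦_⟧ℤ : ℤ → Carrier
  ⟦ + n      ⟧ℤ = n ×ℕ 1#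
  ⟦ -[1+ n ] ⟧ℤ = - (suc n ×ℕ 1#)

  -‿homo : ∀ i → ⟦ ℤ.- i ⟧ℤ ≈ - ⟦ i ⟧ℤ
  -‿homo (+ zero)  = sym -0#≈0#
  -‿homo (+ suc n) = refl
  -‿homo -[1+ n ]  = sym (-‿involutive _)

  ⊖-homo : ∀ m n → ⟦ m ⊖ n ⟧ℤ ≈ m ×ℕ 1# - n ×ℕ 1#
  ⊖-homo m       zero    = sym (trans (+-congˡ -0#≈0#) (+-identityʳ _))
  ⊖-homo zero    (suc n) = sym (+-identityˡ _)
  ⊖-homo (suc m) (suc n) = begin
    ⟦ suc m ⊖ suc n ⟧ℤ               ≡⟨ ≡.cong ⟦_⟧ℤ (ℤ.[1+m]⊖[1+n]≡m⊖n m n) ⟩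
    ⟦ m ⊖ n ⟧ℤ                       ≈⟨ ⊖-homo m n ⟩
    m ×ℕ 1# - n ×ℕ 1#                  ≈⟨ +-congʳ (+-identityʳ _) ⟨
    m ×ℕ 1# + 0# - n ×ℕ 1#             ≈⟨ +-congʳ (+-congˡ (-‿inverseʳ 1#)) ⟨
    m ×ℕ 1# + (1# - 1#) - n ×ℕ 1#      ≈⟨ +-congʳ (+-assoc _ _ _) ⟨
    m ×ℕ 1# + 1# - 1# - n ×ℕ 1#        ≈⟨ +-assoc _ _ _ ⟩
    m ×ℕ 1# + 1# + (- 1# - n ×ℕ 1#)    ≈⟨ +-cong (+-comm _ _) (-‿+-comm _ _) ⟩
    1# + m ×ℕ 1# - (1# + n ×ℕ 1#)      ≈⟨ +-cong (1+× m 1#) (-‿cong (1+× n 1#)) ⟨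
    suc m ×ℕ 1# - suc n ×ℕ 1#          ∎

  +-homo : ∀ i j → ⟦ i ℤ.+ j ⟧ℤ ≈ ⟦ i ⟧ℤ + ⟦ j ⟧ℤ
  +-homo (+ m)    (+ n)    = ×-homo-+ 1# m n
  +-homo (+ m)    -[1+ n ] = ⊖-homo m (suc n)
  +-homo -[1+ m ] (+ n)    = trans (⊖-homo n (suc m)) (+-comm _ _)
  +-homo -[1+ m ] -[1+ n ] = begin
    - (suc (suc (m ℕ.+ n)) ×ℕ 1#)         ≡⟨ ≡.cong (λ k → - (k ×ℕ 1#)) (≡.cong suc (ℕ.+-suc m n)) ⟨
    - ((suc m ℕ.+ suc n) ×ℕ 1#)           ≈⟨ -‿cong (×-homo-+ 1# (suc m) (suc n)) ⟩
    - (suc m ×ℕ 1# + suc n ×ℕ 1#)          ≈⟨ -‿+-comm _ _ ⟨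
    - (suc m ×ℕ 1#) + - (suc n ×ℕ 1#)      ∎

  -- Splitting off a nonnegative second factor leaves only sign changes: `*-homo` moves the sign of
  -- a negative second factor outside the product.
  *-homo⁺ : ∀ i n → ⟦ i ℤ.* + n ⟧ℤ ≈ ⟦ i ⟧ℤ * ⟦ + n ⟧ℤ
  *-homo⁺ (+ m) n = begin
    ⟦ + m ℤ.* + n ⟧ℤ     ≡⟨ ≡.cong ⟦_⟧ℤ (ℤ.pos-* m n) ⟨
    (m ℕ.* n) ×ℕ 1#       ≈⟨ ×1-homo-* m n ⟩
    m ×ℕ 1# * (n ×ℕ 1#)    ∎
  *-homo⁺ -[1+ m ] n = begin
    ⟦ -[1+ m ] ℤ.* + n ⟧ℤ          ≡⟨ ≡.cong ⟦_⟧ℤ (ℤ.neg-distribˡ-* (+ suc m) (+ n)) ⟨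
    ⟦ ℤ.- (+ suc m ℤ.* + n) ⟧ℤ     ≈⟨ -‿homo (+ suc m ℤ.* + n) ⟩
    - ⟦ + suc m ℤ.* + n ⟧ℤ         ≈⟨ -‿cong (*-homo⁺ (+ suc m) n) ⟩
    - (suc m ×ℕ 1# * (n ×ℕ 1#))      ≈⟨ -‿distribˡ-* _ _ ⟩
    - (suc m ×ℕ 1#) * (n ×ℕ 1#)      ∎

  *-homo : ∀ i j → ⟦ i ℤ.* j ⟧ℤ ≈ ⟦ i ⟧ℤ * ⟦ j ⟧ℤ
  *-homo i (+ n)    = *-homo⁺ i n
  *-homo i -[1+ n ] = begin
    ⟦ i ℤ.* -[1+ n ] ⟧ℤ          ≡⟨ ≡.cong ⟦_⟧ℤ (ℤ.neg-distribʳ-* i (+ suc n)) ⟨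
    ⟦ ℤ.- (i ℤ.* + suc n) ⟧ℤ     ≈⟨ -‿homo (i ℤ.* + suc n) ⟩
    - ⟦ i ℤ.* + suc n ⟧ℤ         ≈⟨ -‿cong (*-homo⁺ i (suc n)) ⟩
    - (⟦ i ⟧ℤ * (suc n ×ℕ 1#))    ≈⟨ -‿distribʳ-* _ _ ⟩
    ⟦ i ⟧ℤ * - (suc n ×ℕ 1#)      ∎

  ℤ⟶R : ℤ.+-*-rawRing -Raw-AlmostCommutative⟶ fromCommutativeRing R
  ℤ⟶R = record
    { ⟦_⟧    = ⟦_⟧ℤ
    ; +-homo = +-homo
    ; *-homo = *-homo
    ; -‿homo = -‿homo
    ; 0-homo = refl
    ; 1-homo = refl
    }

  ℤ-coeff≟ : ∀ i j → Maybe (⟦ i ⟧ℤ ≈ ⟦ j ⟧ℤ)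
  ℤ-coeff≟ i j = Maybe.map (reflexive ∘ ≡.cong ⟦_⟧ℤ) (dec⇒maybe (i ℤ.≟ j))

  open import Algebra.Solver.Ring ℤ.+-*-rawRing (fromCommutativeRing R) ℤ⟶R ℤ-coeff≟ public
    using (solve; _:+_; _:*_; _:-_; :-_; con; _:=_)

-- Binomial coefficients modulo p and additivity of the Frobenius map.

prime∤! : ∀ {p} → Prime p → ∀ {k} → k ℕ.< p → ¬ (p ∣ k !)
prime∤! {p} pp {zero}  0<p p∣1 = ℕ.<⇒≱ (ℕ.nonTrivial⇒n>1 p {{prime⇒nonTrivial pp}}) (∣⇒≤ p∣1)
prime∤! {p} pp {suc k} k<p p∣k! =
  [ (λ p∣1+k → ℕ.<⇒≱ k<p (∣⇒≤ p∣1+k))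
  , prime∤! pp (ℕ.<-trans (ℕ.n<1+n k) k<p)
  ]′ (euclidsLemma (suc k) (k !) pp p∣k!)

-- The product of `p C k` with k! (p - k)! is p!, which p divides, whereas p divides neither
-- factorial because k and p - k are both below p.
prime∣C : ∀ {p} → Prime p → ∀ {k} → 0 ℕ.< k → k ℕ.< p → p ∣ p C k
prime∣C {p} pp {k} 0<k k<p =
  [ (λ p∣C → p∣C)
  , (λ p∣k!*[p-k]! → contradiction (euclidsLemma (k !) ((p ∸ k) !) pp p∣k!*[p-k]!)
      [ prime∤! pp k<p , prime∤! pp p∸k<p ]′)
  ]′ (euclidsLemma (p C k) (k ! ℕ.* (p ∸ k) !) pp (≡.subst (p ∣_) (≡.sym C*k![p-k]!≡p!) (p∣p! pp)))
  where
  instance _ = k ℕ.!* (p ∸ k) !≢0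
  p∸k<p : p ∸ k ℕ.< p
  p∸k<p = ℕ.∸-monoʳ-< 0<k (ℕ.<⇒≤ k<p)
  p∣p! : ∀ {p} → Prime p → p ∣ p !
  p∣p! {suc p} _ = m∣m*n (p !)
  C*k![p-k]!≡p! : (p C k) ℕ.* (k ! ℕ.* (p ∸ k) !) ≡ p !
  C*k![p-k]!≡p! = ≡.trans (≡.cong (ℕ._* (k ! ℕ.* (p ∸ k) !)) (nCk≡n!/k![n-k]! (ℕ.<⇒≤ k<p)))
    (m/n*n≡m (k![n∸k]!∣n! (ℕ.<⇒≤ k<p)))

module PrimeCharacteristic (R : CommutativeSemiring 0ℓ 0ℓ) where
  open CommutativeSemiring R
  open import Algebra.Properties.CommutativeSemiring.Binomial R
  open import Algebra.Properties.CommutativeSemiring.Exp R using (_^_; ^-assocʳ; ^-congˡ)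
  open import Algebra.Properties.Semiring.Mult semiring
    using (×-homo-1; ×-assocˡ; ×-congʳ; ×-assoc-*) renaming (_×_ to _×ℕ_)
  open import Algebra.Properties.Semiring.Sum semiring
    using (sum; sum-init-last; sum-cong-≋; sum-replicate-zero)
  open import Relation.Binary.Reasoning.Setoid setoid

  ∣⇒×≈0 : ∀ {m n} → m ×ℕ 1# ≈ 0# → m ∣ n → ∀ x → n ×ℕ x ≈ 0#
  ∣⇒×≈0 {m} m×1≈0 (divides k ≡.refl) x = begin
    (k ℕ.* m) ×ℕ x         ≡⟨ ≡.cong (_×ℕ x) (ℕ.*-comm k m) ⟩
    (m ℕ.* k) ×ℕ x         ≈⟨ ×-assocˡ x m k ⟨
    m ×ℕ (k ×ℕ x)           ≈⟨ ×-congʳ m (*-identityˡ _) ⟨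
    m ×ℕ (1# * (k ×ℕ x))    ≈⟨ ×-assoc-* m 1# _ ⟨
    m ×ℕ 1# * (k ×ℕ x)      ≈⟨ *-congʳ m×1≈0 ⟩
    0# * (k ×ℕ x)          ≈⟨ zeroˡ _ ⟩
    0#                    ∎

  -- In the binomial expansion every inner coefficient is a multiple of p and vanishes, which leaves
  -- only the two end terms.
  ^p-distrib-+ : ∀ {p} → Prime p → p ×ℕ 1# ≈ 0# → ∀ x y → (x + y) ^ p ≈ x ^ p + y ^ p
  ^p-distrib-+ {suc n} pp p×1≈0 x y = begin
    (x + y) ^ p                               ≈⟨ theorem p x y ⟩
    t Fin.zero + sum (t ∘ Fin.suc)            ≈⟨ +-congˡ (sum-init-last (t ∘ Fin.suc)) ⟩
    t Fin.zero + (sum inner + t (Fin.suc (Fin.fromℕ n)))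
      ≈⟨ +-cong t₀ (+-cong (trans (sum-cong-≋ inner≈0) (sum-replicate-zero n)) tₚ) ⟩
    y ^ p + (0# + x ^ p)                      ≈⟨ +-congˡ (+-identityˡ _) ⟩
    y ^ p + x ^ p                             ≈⟨ +-comm _ _ ⟩
    x ^ p + y ^ p                             ∎
    where
    p = suc n
    t = binomialTerm x y p
    inner : Fin n → Carrier
    inner i = t (Fin.suc (Fin.inject₁ i))
    inner≈0 : ∀ i → inner i ≈ 0#
    inner≈0 i = ∣⇒×≈0 p×1≈0 (prime∣C pp (s≤s z≤n)
      (s≤s (≡.subst (ℕ._< n) (≡.sym (Fin.toℕ-inject₁ i)) (Fin.toℕ<n i)))) _
    t₀ : t Fin.zero ≈ y ^ p
    t₀ = trans (×-homo-1 _) (*-identityˡ _)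
    tₚ : t (Fin.suc (Fin.fromℕ n)) ≈ x ^ p
    tₚ rewrite Fin.toℕ-fromℕ n | nCn≡1 p | ℕ.n∸n≡0 n = trans (×-homo-1 _) (*-identityʳ _)

  ^pᵏ-distrib-+ : ∀ {p} → Prime p → p ×ℕ 1# ≈ 0# → ∀ k x y →
                  (x + y) ^ (p ℕ.^ k) ≈ x ^ (p ℕ.^ k) + y ^ (p ℕ.^ k)
  ^pᵏ-distrib-+ {p} pp p×1≈0 zero    x y = trans (*-identityʳ _) (sym (+-cong (*-identityʳ _) (*-identityʳ _)))
  ^pᵏ-distrib-+ {p} pp p×1≈0 (suc k) x y = begin
    (x + y) ^ (p ℕ.* pᵏ)               ≈⟨ ^-assocʳ (x + y) p pᵏ ⟨
    ((x + y) ^ p) ^ pᵏ                 ≈⟨ ^-congˡ pᵏ (^p-distrib-+ pp p×1≈0 x y) ⟩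
    (x ^ p + y ^ p) ^ pᵏ               ≈⟨ ^pᵏ-distrib-+ pp p×1≈0 k (x ^ p) (y ^ p) ⟩
    (x ^ p) ^ pᵏ + (y ^ p) ^ pᵏ        ≈⟨ +-cong (^-assocʳ x p pᵏ) (^-assocʳ y p pᵏ) ⟩
    x ^ (p ℕ.* pᵏ) + y ^ (p ℕ.* pᵏ)    ∎
    where pᵏ = p ℕ.^ k

open ≡ using (refl; sym; trans; cong; cong₂; subst)

-- Arithmetic in a field with N elements.

module Field {N : ℕ} (K : FiniteField N) where
  open FiniteField K
  open Inverse enumeration using (to; from; strictlyInverseˡ; strictlyInverseʳ)

  ring : CommutativeRing 0ℓ 0ℓ
  ring = record { isCommutativeRing = isCommutativeRing }

  open CommutativeRing ring public
    using ( +-identityˡ; +-identityʳ; +-comm; +-assoc; -‿inverseʳ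
          ; *-identityˡ; *-identityʳ; *-comm; *-assoc; zeroˡ; zeroʳ
          ; +-group; +-commutativeMonoid; *-commutativeMonoid; semiring; commutativeSemiring)
  open IntegerCoefficients ring public
    using (solve; _:+_; _:*_; _:-_; :-_; con; _:=_)
  open import Algebra.Properties.Group +-group public using () renaming (∙-cancelˡ to +-cancelˡ)
  import Algebra.Properties.CommutativeSemiring.Exp commutativeSemiring as Exp
  open import Algebra.Properties.Semiring.Mult semiring using (×1-homo-*) renaming (_×_ to _×ℕ_)
  import Algebra.Properties.CommutativeMonoid.Sum +-commutativeMonoid as Σ
  import Algebra.Properties.CommutativeMonoid.Sum *-commutativeMonoid as Π
  open ≡.≡-Reasoning

  from-injective : Injective _≡_ _≡_ from
  from-injective {i} {j} eq = trans (sym (strictlyInverseˡ i)) (trans (cong to eq) (strictlyInverseˡ j))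

  to-injective : Injective _≡_ _≡_ to
  to-injective {x} {y} eq = trans (sym (strictlyInverseʳ x)) (trans (cong from eq) (strictlyInverseʳ y))

  infix 4 _≟_
  _≟_ : DecidableEquality Carrier
  x ≟ y = map′ to-injective (cong to) (to x Fin.≟ to y)

  x-y≡0⇒x≡y : ∀ {x y} → x + - y ≡ 0# → x ≡ y
  x-y≡0⇒x≡y {x} {y} eq = begin
    x              ≡⟨ solve 2 (λ x y → x := x :- y :+ y) refl x y ⟩
    x + - y + y    ≡⟨ cong (_+ y) eq ⟩
    0# + y         ≡⟨ +-identityˡ y ⟩
    y              ∎

  x≡y⇒x-y≡0 : ∀ {x y} → x ≡ y → x + - y ≡ 0#
  x≡y⇒x-y≡0 {x} refl = -‿inverseʳ x

  *-cancelˡ-nonzero : ∀ {x y z} → x ≢ 0# → x * y ≡ x * z → y ≡ z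
  *-cancelˡ-nonzero {x} {y} {z} x≢0 eq with x⁻¹ , xx⁻¹≡1 ← inverse x x≢0 = begin
    y                ≡⟨ divide y ⟩
    x⁻¹ * (x * y)    ≡⟨ cong (x⁻¹ *_) eq ⟩
    x⁻¹ * (x * z)    ≡⟨ divide z ⟨
    z                ∎
    where
    divide : ∀ y → y ≡ x⁻¹ * (x * y)
    divide y = begin
      y                ≡⟨ *-identityˡ y ⟨
      1# * y           ≡⟨ cong (_* y) xx⁻¹≡1 ⟨
      x * x⁻¹ * y      ≡⟨ solve 3 (λ x u y → x :* u :* y := u :* (x :* y)) refl x x⁻¹ y ⟩
      x⁻¹ * (x * y)    ∎

  x*y≡0⇒x≡0∨y≡0 : ∀ {x y} → x * y ≡ 0# → x ≡ 0# ⊎ y ≡ 0#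
  x*y≡0⇒x≡0∨y≡0 {x} {y} eq with x ≟ 0#
  ... | yes x≡0 = inj₁ x≡0
  ... | no  x≢0 = inj₂ (*-cancelˡ-nonzero x≢0 (trans eq (sym (zeroʳ x))))

  x≢0∧x*y≡0⇒y≡0 : ∀ {x y} → x ≢ 0# → x * y ≡ 0# → y ≡ 0#
  x≢0∧x*y≡0⇒y≡0 x≢0 eq = [ (λ x≡0 → contradiction x≡0 x≢0) , (λ y≡0 → y≡0) ]′ (x*y≡0⇒x≡0∨y≡0 eq)

  x*y≢0 : ∀ {x y} → x ≢ 0# → y ≢ 0# → x * y ≢ 0#
  x*y≢0 x≢0 y≢0 = [ x≢0 , y≢0 ]′ ∘ x*y≡0⇒x≡0∨y≡0

  ^≡^ : ∀ x n → x ^ n ≡ x Exp.^ n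
  ^≡^ x zero    = refl
  ^≡^ x (suc n) = cong (x *_) (^≡^ x n)

  ^-homo-* : ∀ x m n → x ^ (m ℕ.+ n) ≡ x ^ m * x ^ n
  ^-homo-* x m n rewrite ^≡^ x m | ^≡^ x n | ^≡^ x (m ℕ.+ n) = Exp.^-homo-* x m n

  ^-assocʳ : ∀ x m n → (x ^ m) ^ n ≡ x ^ (m ℕ.* n)
  ^-assocʳ x m n rewrite ^≡^ x m | ^≡^ (x Exp.^ m) n | ^≡^ x (m ℕ.* n) = Exp.^-assocʳ x m n

  ^-distrib-* : ∀ x y n → (x * y) ^ n ≡ x ^ n * y ^ n
  ^-distrib-* x y n rewrite ^≡^ x n | ^≡^ y n | ^≡^ (x * y) n = Exp.^-distrib-* x y n

  1^ : ∀ n → 1# ^ n ≡ 1#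
  1^ zero    = refl
  1^ (suc n) = trans (*-identityˡ _) (1^ n)

  ^≢0 : ∀ {x} n → x ≢ 0# → x ^ n ≢ 0#
  ^≢0 zero    x≢0 = 1≢0
  ^≢0 (suc n) x≢0 = x*y≢0 x≢0 (^≢0 n x≢0)

  -- Translation by 1 permutes the field, so the sum of all elements is unchanged when N copies of 1
  -- are added to it.
  N×1≡0 : N ×ℕ 1# ≡ 0#
  N×1≡0 = +-cancelˡ (Σ.sum from) _ _ $ begin
    Σ.sum from + N ×ℕ 1#                    ≡⟨ cong (_+_ (Σ.sum from)) (Σ.sum-replicate N) ⟨
    Σ.sum from + Σ.sum {N} (λ _ → 1#)       ≡⟨ Σ.∑-distrib-+ from (λ _ → 1#) ⟨
    Σ.sum (λ i → from i + 1#)               ≡⟨ Σ.sum-cong-≗ (λ i → strictlyInverseʳ (from i + 1#)) ⟨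
    Σ.sum (λ i → from (to (from i + 1#)))   ≡⟨ Σ.sum-permute from shift ⟨
    Σ.sum from                              ≡⟨ +-identityʳ _ ⟨
    Σ.sum from + 0#                         ∎
    where
    shift : Permutation′ N
    shift = permutation (λ i → to (from i + 1#)) (λ i → to (from i + - 1#))
      (λ i → trans (cong (to ∘ (_+ 1#)) (strictlyInverseʳ _))
        (trans (cong to (solve 1 (λ x → x :- con 1ℤ :+ con 1ℤ := x) refl (from i))) (strictlyInverseˡ i)))
      (λ i → trans (cong (to ∘ (_+ - 1#)) (strictlyInverseʳ _))
        (trans (cong to (solve 1 (λ x → x :+ con 1ℤ :- con 1ℤ := x) refl (from i))) (strictlyInverseˡ i)))

  ×1≡×1^ : ∀ p n → (p ℕ.^ n) ×ℕ 1# ≡ (p ×ℕ 1#) ^ n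
  ×1≡×1^ p zero    = +-identityʳ 1#
  ×1≡×1^ p (suc n) = trans (×1-homo-* p (p ℕ.^ n)) (cong (p ×ℕ 1# *_) (×1≡×1^ p n))

  -- The nth power of p · 1 is N · 1 = 0, and a field has no nonzero nilpotents.
  p×1≡0 : ∀ p n → N ≡ p ℕ.^ n → p ×ℕ 1# ≡ 0#
  p×1≡0 p n N≡pⁿ with p ×ℕ 1# ≟ 0#
  ... | yes eq = eq
  ... | no neq = contradiction (trans (sym (×1≡×1^ p n)) (trans (cong (_×ℕ 1#) (sym N≡pⁿ)) N×1≡0)) (^≢0 n neq)

  ^pᵏ-distrib-+ : ∀ p → Prime p → ∀ n → N ≡ p ℕ.^ n → ∀ k x y →
                  (x + y) ^ (p ℕ.^ k) ≡ x ^ (p ℕ.^ k) + y ^ (p ℕ.^ k)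
  ^pᵏ-distrib-+ p pp n N≡pⁿ k x y
    rewrite ^≡^ (x + y) (p ℕ.^ k) | ^≡^ x (p ℕ.^ k) | ^≡^ y (p ℕ.^ k)
    = PrimeCharacteristic.^pᵏ-distrib-+ commutativeSemiring pp (p×1≡0 p n N≡pⁿ) k x y

  -- Fermat's little theorem in K.

  module _ {x : Carrier} (x≢0 : x ≢ 0#) where
    private
      -- Zero is replaced by one, so that the product over the whole field is invertible.
      unit : Carrier → Carrier
      unit y with y ≟ 0#
      ... | yes _ = 1#
      ... | no  _ = y

      factor : Carrier → Carrier
      factor y with y ≟ 0#
      ... | yes _ = 1#
      ... | no  _ = x

      unit≢0 : ∀ y → unit y ≢ 0#
      unit≢0 y with y ≟ 0#
      ... | yes _   = 1≢0
      ... | no  y≢0 = y≢0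

      unit-x* : ∀ y → unit (x * y) ≡ factor y * unit y
      unit-x* y with y ≟ 0# | x * y ≟ 0#
      ... | yes _    | yes _    = sym (*-identityˡ 1#)
      ... | yes refl | no  xy≢0 = contradiction (zeroʳ x) xy≢0
      ... | no  y≢0  | yes xy≡0 = contradiction xy≡0 (x*y≢0 x≢0 y≢0)
      ... | no  _    | no  _    = refl

      x⁻¹ = proj₁ (inverse x x≢0)

      cancel : ∀ y → x * (x⁻¹ * y) ≡ y
      cancel y = trans (sym (*-assoc _ _ _)) (trans (cong (_* y) (proj₂ (inverse x x≢0))) (*-identityˡ y))

      scale : Permutation′ N
      scale = permutation (λ i → to (x * from i)) (λ i → to (x⁻¹ * from i))
        (λ i → trans (cong (to ∘ (x *_)) (strictlyInverseʳ _)) (trans (cong to (cancel (from i))) (strictlyInverseˡ i)))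
        (λ i → trans (cong (to ∘ (x⁻¹ *_)) (strictlyInverseʳ _))
          (trans (cong to (trans (solve 3 (λ x u y → u :* (x :* y) := x :* (u :* y)) refl x x⁻¹ (from i)) (cancel (from i))))
            (strictlyInverseˡ i)))

      Π≢0 : ∀ {n} (f : Fin n → Carrier) → (∀ i → f i ≢ 0#) → Π.sum f ≢ 0#
      Π≢0 {zero}  f f≢0 = 1≢0
      Π≢0 {suc n} f f≢0 = x*y≢0 (f≢0 Fin.zero) (Π≢0 (f ∘ Fin.suc) (f≢0 ∘ Fin.suc))

      Π-const : ∀ {n} (f : Fin n → Carrier) → (∀ i → f i ≡ x) → Π.sum f ≡ x ^ n
      Π-const {n} f f≡x = trans (Π.sum-cong-≗ f≡x) (trans (Π.sum-replicate n) (sym (^≡^ x n)))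

      -- By injectivity exactly one index maps to zero. It contributes 1, and each of the other n -
      -- 1 indices contributes x.
      Π-factor : ∀ {n} (e : Fin n → Carrier) → Injective _≡_ _≡_ e → ∀ i → e i ≡ 0# →
                 Π.sum (factor ∘ e) ≡ x ^ ℕ.pred n
      Π-factor {suc n} e e-inj i ei≡0 = begin
        Π.sum (factor ∘ e)                                          ≡⟨ Π.sum-remove {i = i} (factor ∘ e) ⟩
        factor (e i) * Π.sum (removeAt (factor ∘ e) i)              ≡⟨ cong₂ _*_ factor-0 (Π-const _ factor-≢0) ⟩
        1# * x ^ n                                                  ≡⟨ *-identityˡ _ ⟩
        x ^ n                                                       ∎
        where
        factor-0 : factor (e i) ≡ 1#
        factor-0 with e i ≟ 0#
        ... | yes _    = refl
        ... | no  ei≢0 = contradiction ei≡0 ei≢0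
        factor-≢0 : ∀ j → factor (e (punchIn i j)) ≡ x
        factor-≢0 j with e (punchIn i j) ≟ 0#
        ... | yes ej≡0 = contradiction (e-inj (trans ej≡0 (sym ei≡0))) (Fin.punchInᵢ≢i i j)
        ... | no  _    = refl

    -- Multiplication by x permutes the field, so it preserves the product of the nonzero elements
    -- while multiplying it by x once for each of them.
    x^[N-1]≡1 : x ^ ℕ.pred N ≡ 1#
    x^[N-1]≡1 = *-cancelˡ-nonzero (Π≢0 (unit ∘ from) (unit≢0 ∘ from)) $ begin
      Π.sum (unit ∘ from) * x ^ ℕ.pred N                    ≡⟨ *-comm _ _ ⟩
      x ^ ℕ.pred N * Π.sum (unit ∘ from)                    ≡⟨ cong (_* Π.sum (unit ∘ from)) (Π-factor from from-injective (to 0#) (strictlyInverseʳ 0#)) ⟨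
      Π.sum (factor ∘ from) * Π.sum (unit ∘ from)           ≡⟨ Π.∑-distrib-+ (factor ∘ from) (unit ∘ from) ⟨
      Π.sum (λ i → factor (from i) * unit (from i))         ≡⟨ Π.sum-cong-≗ (λ i → unit-x* (from i)) ⟨
      Π.sum (λ i → unit (x * from i))                       ≡⟨ Π.sum-cong-≗ (λ i → cong unit (strictlyInverseʳ (x * from i))) ⟨
      Π.sum (λ i → unit (from (to (x * from i))))           ≡⟨ Π.sum-permute (unit ∘ from) scale ⟨
      Π.sum (unit ∘ from)                                   ≡⟨ *-identityʳ _ ⟨
      Π.sum (unit ∘ from) * 1#                              ∎

  1+pred[N]≡N : suc (ℕ.pred N) ≡ N
  1+pred[N]≡N = ℕ.suc-pred N {{Fin.nonZeroIndex (to 0#)}}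

  x^N≡x : ∀ x → x ^ N ≡ x
  x^N≡x x with x ≟ 0#
  ... | yes refl = trans (cong (0# ^_) (sym 1+pred[N]≡N)) (zeroˡ _)
  ... | no  x≢0  = begin
    x ^ N                 ≡⟨ cong (x ^_) 1+pred[N]≡N ⟨
    x * x ^ ℕ.pred N      ≡⟨ cong (x *_) (x^[N-1]≡1 x≢0) ⟩
    x * 1#                ≡⟨ *-identityʳ x ⟩
    x                     ∎

  -- Monic polynomials and the bound on their number of roots.

  -- Horner form of a polynomial function with leading coefficient 1. As a property of functions it
  -- can hold in several degrees, and the root bound is valid for each of them.
  Monic : ℕ → (Carrier → Carrier) → Set
  Monic zero    f = ∀ x → f x ≡ 1#
  Monic (suc d) f = ∃₂ λ g c → Monic d g × ∀ x → f x ≡ x * g x + c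

  monic-cong : ∀ {d f g} → (∀ x → f x ≡ g x) → Monic d f → Monic d g
  monic-cong {zero}  f≗g f≗1 x = trans (sym (f≗g x)) (f≗1 x)
  monic-cong {suc d} f≗g (h , c , hm , f≗) = h , c , hm , λ x → trans (sym (f≗g x)) (f≗ x)

  monic-x*ᵏ : ∀ k {d f} → Monic d f → Monic (k ℕ.+ d) (λ x → x ^ k * f x)
  monic-x*ᵏ zero    fm = monic-cong (λ x → sym (*-identityˡ _)) fm
  monic-x*ᵏ (suc k) fm = _ , 0# , monic-x*ᵏ k fm , λ x → trans (*-assoc _ _ _) (sym (+-identityʳ _))

  monic-+c : ∀ {d f} c → 0 ℕ.< d → Monic d f → Monic d (λ x → f x + c)
  monic-+c {suc d} c 0<d (g , c′ , gm , f≗) = g , c′ + c , gm , λ x → trans (cong (_+ c) (f≗ x)) (+-assoc _ _ _)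

  monic-x^ : ∀ k → Monic k (_^ k)
  monic-x^ k = subst (λ d → Monic d (_^ k)) (ℕ.+-identityʳ k)
    (monic-cong (λ x → *-identityʳ _) (monic-x*ᵏ k {zero} (λ _ → refl)))

  -- Synthetic division by x - a, with remainder f(a).
  monic-factor : ∀ {d f} → Monic (suc d) f → ∀ a →
                 ∃ λ h → Monic d h × ∀ x → f x ≡ (x + - a) * h x + f a
  monic-factor {zero} {f} (g , c , g≗1 , f≗) a = g , g≗1 , λ x → begin
    f x                            ≡⟨ f≗ x ⟩
    x * g x + c                    ≡⟨ solve 4 (λ x a g c → x :* g :+ c := (x :- a) :* g :+ (a :* g :+ c)) refl x a (g x) c ⟩
    (x + - a) * g x + (a * g x + c)  ≡⟨ cong₂ (λ g g′ → (x + - a) * g + (a * g′ + c)) refl (trans (g≗1 x) (sym (g≗1 a))) ⟩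
    (x + - a) * g x + (a * g a + c)  ≡⟨ cong (_ +_) (f≗ a) ⟨
    (x + - a) * g x + f a          ∎
  monic-factor {suc d} {f} (g , c , gm , f≗) a with h , hm , g≗ ← monic-factor gm a =
    (λ x → x * h x + g a) , (h , g a , hm , λ _ → refl) , λ x → begin
      f x                                               ≡⟨ f≗ x ⟩
      x * g x + c                                       ≡⟨ cong (λ u → x * u + c) (g≗ x) ⟩
      x * ((x + - a) * h x + g a) + c
        ≡⟨ solve 5 (λ x a h g c → x :* ((x :- a) :* h :+ g) :+ c := (x :- a) :* (x :* h :+ g) :+ (a :* g :+ c)) refl x a (h x) (g a) c ⟩
      (x + - a) * (x * h x + g a) + (a * g a + c)       ≡⟨ cong (_ +_) (f≗ a) ⟨
      (x + - a) * (x * h x + g a) + f a                 ∎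

  -- After division by x - `e` 0, the other roots differ from `e` 0 and are therefore roots of the
  -- quotient, whose degree is one less.
  roots≤degree : ∀ {d f} → Monic d f → ∀ {n} (e : Fin n → Carrier) → Injective _≡_ _≡_ e →
                 (∀ i → f (e i) ≡ 0#) → n ℕ.≤ d
  roots≤degree fm {zero} e e-inj roots = z≤n
  roots≤degree {zero}  f≗1 {suc n} e e-inj roots = contradiction (trans (sym (f≗1 _)) (roots Fin.zero)) 1≢0
  roots≤degree {suc d} {f} fm {suc n} e e-inj roots with h , hm , f≗ ← monic-factor fm (e Fin.zero) =
    s≤s (roots≤degree hm (e ∘ Fin.suc) (Fin.suc-injective ∘ e-inj) λ i →
      x≢0∧x*y≡0⇒y≡0 (λ eq → contradiction (e-inj (x-y≡0⇒x≡y eq)) λ ()) $ begin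
        (e (Fin.suc i) + - e Fin.zero) * h (e (Fin.suc i))                   ≡⟨ +-identityʳ _ ⟨
        (e (Fin.suc i) + - e Fin.zero) * h (e (Fin.suc i)) + 0#              ≡⟨ cong (_ +_) (roots Fin.zero) ⟨
        (e (Fin.suc i) + - e Fin.zero) * h (e (Fin.suc i)) + f (e Fin.zero)  ≡⟨ f≗ _ ⟨
        f (e (Fin.suc i))                                                    ≡⟨ roots (Fin.suc i) ⟩
        0#                                                                   ∎)

  nonroot : ∀ {d f} → Monic d f → d ℕ.< N → ∃ λ x → f x ≢ 0#
  nonroot {f = f} fm d<N with i , fi≢0 ← Fin.¬∀⟶∃¬ N _ (λ i → f (from i) ≟ 0#)
    (λ roots → ℕ.<⇒≱ d<N (roots≤degree fm from from-injective roots)) = from i , fi≢0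

-- Linear relations between the conjugates of x.

module Trinomial {N : ℕ} (K : FiniteField N) (b : FiniteField.Carrier K)
  (b²+b≡1 : FiniteField._+_ K (FiniteField._*_ K b b) b ≡ FiniteField.1# K)
  where
  open FiniteField K
  open Field K
  open ≡.≡-Reasoning

  infixr 7 _⊠_
  infixl 6 _⊞_

  -- Together with `_⊞_` this evaluates a linear combination of vanishing terms. The solver
  -- identities below write their goals as such combinations, that is, as certificates of ideal
  -- membership.
  _⊠_ : ∀ {x} c → x ≡ 0# → c * x ≡ 0#
  c ⊠ refl = zeroʳ c

  _⊞_ : ∀ {x y} → x ≡ 0# → y ≡ 0# → x + y ≡ 0#
  refl ⊞ refl = +-identityˡ 0#

  b²+b-1≡0 : b * b + b + - 1# ≡ 0#
  b²+b-1≡0 = x≡y⇒x-y≡0 b²+b≡1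

  -- The conjugates are independent variables here, so that all six conjugates of g x = m x have
  -- this one form with cyclically shifted arguments.
  Equation : (m x x₁ x₃ x₅ : Carrier) → Set
  Equation m x x₁ x₃ x₅ = x₁ + x₃ + b * x₅ ≡ m * x

  -- The circulant matrix with rows (1,1,b), (b,1,1), (1,b,1) has inverse with entries 1 and - (1 + b).
  solve-circulant : ∀ {u v w x₁ x₃ x₅} → x₁ + x₃ + b * x₅ ≡ w → x₃ + x₅ + b * x₁ ≡ u → x₅ + x₁ + b * x₃ ≡ v →
                    x₁ ≡ w + - ((1# + b) * u) + v
  solve-circulant {x₁ = x₁} {x₃} {x₅} refl refl refl = x-y≡0⇒x≡y (trans
    (solve 4 (λ b x₁ x₃ x₅ →
        x₁ :- (x₁ :+ x₃ :+ b :* x₅ :- (con 1ℤ :+ b) :* (x₃ :+ x₅ :+ b :* x₁) :+ (x₅ :+ x₁ :+ b :* x₃))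
        := x₁ :* (b :* b :+ b :- con 1ℤ)) refl b x₁ x₃ x₅)
    (x₁ ⊠ b²+b-1≡0))

  row : ∀ {m₀ m₁ m₂ m₄ x₀ x₁ x₂ x₃ x₄ x₅} →
        Equation m₀ x₀ x₁ x₃ x₅ → Equation m₁ x₁ x₂ x₄ x₀ → Equation m₂ x₂ x₃ x₅ x₁ → Equation m₄ x₄ x₅ x₁ x₃ →
        (b + - (m₀ * m₁)) * x₀ + (1# + (1# + b) * (m₁ * m₂)) * x₂ + (1# + - (m₁ * m₄)) * x₄ ≡ 0#
  row {m₀} {m₁} {m₂} {m₄} {x₀} {x₁} {x₂} {x₃} {x₄} {x₅} e₀ e₁ e₂ e₄ = trans
    (solve 8 (λ b m₀ m₁ m₂ m₄ x₀ x₂ x₄ →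
        (b :- m₀ :* m₁) :* x₀ :+ (con 1ℤ :+ (con 1ℤ :+ b) :* (m₁ :* m₂)) :* x₂ :+ (con 1ℤ :- m₁ :* m₄) :* x₄
        := x₂ :+ x₄ :+ b :* x₀ :- m₁ :* (m₀ :* x₀ :- (con 1ℤ :+ b) :* (m₂ :* x₂) :+ m₄ :* x₄))
      refl b m₀ m₁ m₂ m₄ x₀ x₂ x₄)
    (x≡y⇒x-y≡0 (trans e₁ (cong (m₁ *_) (solve-circulant e₀ e₂ e₄))))

  -- Two rows orthogonal to the vectors x and y are both multiples of the cross product x × y.
  module _ {x₁ x₂ x₃ y₁ y₂ y₃ p₁ p₂ p₃ r₁ r₂ r₃ : Carrier}
    (x₁y₂-x₂y₁≢0 : x₁ * y₂ + - (x₂ * y₁) ≢ 0#)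
    (p∙x≡0 : p₁ * x₁ + p₂ * x₂ + p₃ * x₃ ≡ 0#) (p∙y≡0 : p₁ * y₁ + p₂ * y₂ + p₃ * y₃ ≡ 0#)
    (r∙x≡0 : r₁ * x₁ + r₂ * x₂ + r₃ * x₃ ≡ 0#) (r∙y≡0 : r₁ * y₁ + r₂ * y₂ + r₃ * y₃ ≡ 0#)
    where
    private
      w₁ = x₂ * y₃ + - (x₃ * y₂)
      w₂ = x₃ * y₁ + - (x₁ * y₃)
      w₃ = x₁ * y₂ + - (x₂ * y₁)

      cross₁ : ∀ {p₁ p₂ p₃} → p₁ * x₁ + p₂ * x₂ + p₃ * x₃ ≡ 0# → p₁ * y₁ + p₂ * y₂ + p₃ * y₃ ≡ 0# →
               w₃ * p₁ + - (p₃ * w₁) ≡ 0#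
      cross₁ {p₁} {p₂} {p₃} p∙x≡0 p∙y≡0 = trans
        (solve 9 (λ x₁ x₂ x₃ y₁ y₂ y₃ p₁ p₂ p₃ →
            (x₁ :* y₂ :- x₂ :* y₁) :* p₁ :- p₃ :* (x₂ :* y₃ :- x₃ :* y₂)
            := y₂ :* (p₁ :* x₁ :+ p₂ :* x₂ :+ p₃ :* x₃) :+ (:- x₂) :* (p₁ :* y₁ :+ p₂ :* y₂ :+ p₃ :* y₃))
          refl x₁ x₂ x₃ y₁ y₂ y₃ p₁ p₂ p₃)
        (y₂ ⊠ p∙x≡0 ⊞ (- x₂) ⊠ p∙y≡0)

      cross₂ : ∀ {p₁ p₂ p₃} → p₁ * x₁ + p₂ * x₂ + p₃ * x₃ ≡ 0# → p₁ * y₁ + p₂ * y₂ + p₃ * y₃ ≡ 0# →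
               w₃ * p₂ + - (p₃ * w₂) ≡ 0#
      cross₂ {p₁} {p₂} {p₃} p∙x≡0 p∙y≡0 = trans
        (solve 9 (λ x₁ x₂ x₃ y₁ y₂ y₃ p₁ p₂ p₃ →
            (x₁ :* y₂ :- x₂ :* y₁) :* p₂ :- p₃ :* (x₃ :* y₁ :- x₁ :* y₃)
            := x₁ :* (p₁ :* y₁ :+ p₂ :* y₂ :+ p₃ :* y₃) :+ (:- y₁) :* (p₁ :* x₁ :+ p₂ :* x₂ :+ p₃ :* x₃))
          refl x₁ x₂ x₃ y₁ y₂ y₃ p₁ p₂ p₃)
        (x₁ ⊠ p∙y≡0 ⊞ (- y₁) ⊠ p∙x≡0)

    minor₁₃≡0 : p₁ * r₃ + - (p₃ * r₁) ≡ 0#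
    minor₁₃≡0 = x≢0∧x*y≡0⇒y≡0 x₁y₂-x₂y₁≢0 (trans
      (solve 6 (λ w₁ w₃ p₁ p₃ r₁ r₃ →
          w₃ :* (p₁ :* r₃ :- p₃ :* r₁) := r₃ :* (w₃ :* p₁ :- p₃ :* w₁) :+ (:- p₃) :* (w₃ :* r₁ :- r₃ :* w₁))
        refl w₁ w₃ p₁ p₃ r₁ r₃)
      (r₃ ⊠ cross₁ p∙x≡0 p∙y≡0 ⊞ (- p₃) ⊠ cross₁ r∙x≡0 r∙y≡0))

    minor₁₂≡0 : p₁ * r₂ + - (p₂ * r₁) ≡ 0#
    -- `cross₁` and `cross₂` express the first two entries through the third, at the cost of a
    -- factor `w₃` each. Hence `w₃` is cancelled twice.
    minor₁₂≡0 = x≢0∧x*y≡0⇒y≡0 x₁y₂-x₂y₁≢0 (x≢0∧x*y≡0⇒y≡0 x₁y₂-x₂y₁≢0 (trans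
      (solve 9 (λ w₁ w₂ w₃ p₁ p₂ p₃ r₁ r₂ r₃ →
          w₃ :* (w₃ :* (p₁ :* r₂ :- p₂ :* r₁))
          := w₃ :* (r₂ :* (w₃ :* p₁ :- p₃ :* w₁) :+ (:- r₁) :* (w₃ :* p₂ :- p₃ :* w₂))
             :+ p₃ :* (w₁ :* (w₃ :* r₂ :- r₃ :* w₂) :+ (:- w₂) :* (w₃ :* r₁ :- r₃ :* w₁)))
        refl w₁ w₂ w₃ p₁ p₂ p₃ r₁ r₂ r₃)
      (w₃ ⊠ (r₂ ⊠ cross₁ p∙x≡0 p∙y≡0 ⊞ (- r₁) ⊠ cross₂ p∙x≡0 p∙y≡0)
       ⊞ p₃ ⊠ (w₁ ⊠ cross₂ r∙x≡0 r∙y≡0 ⊞ (- w₂) ⊠ cross₁ r∙x≡0 r∙y≡0))))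

  -- The contradiction from two independent solutions, for an automorphism `φ` that stands for x ↦
  -- x^q.

  module Semilinear (φ : Carrier → Carrier)
    (φ-+ : ∀ x y → φ (x + y) ≡ φ x + φ y) (φ-* : ∀ x y → φ (x * y) ≡ φ x * φ y)
    (φ⁶≡id : ∀ x → φ (φ (φ (φ (φ (φ x))))) ≡ x)
    (φb≡b : φ b ≡ b) (2≢0 : 1# + 1# ≢ 0#)
    where

    φ-injective : ∀ {x y} → φ x ≡ φ y → x ≡ y
    φ-injective {x} {y} eq = trans (sym (φ⁶≡id x)) (trans (cong (λ z → φ (φ (φ (φ (φ z))))) eq) (φ⁶≡id y))

    φ0≡0 : φ 0# ≡ 0#
    φ0≡0 = +-cancelˡ (φ 0#) _ _ (trans (sym (φ-+ 0# 0#)) (trans (cong φ (+-identityˡ 0#)) (sym (+-identityʳ _))))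

    -- `φ 1#` is idempotent, and nonzero by injectivity.
    φ1≡1 : φ 1# ≡ 1#
    φ1≡1 = *-cancelˡ-nonzero (λ φ1≡0 → 1≢0 (φ-injective (trans φ1≡0 (sym φ0≡0))))
      (trans (sym (φ-* 1# 1#)) (trans (cong φ (*-identityˡ 1#)) (sym (*-identityʳ _))))

    φ≢0 : ∀ {x} → x ≢ 0# → φ x ≢ 0#
    φ≢0 x≢0 φx≡0 = x≢0 (φ-injective (trans φx≡0 (sym φ0≡0)))

    g : Carrier → Carrier
    g x = φ x + φ (φ (φ x)) + b * φ (φ (φ (φ (φ x))))

    φ-equation : ∀ {m x x₁ x₃ x₅} → Equation m x x₁ x₃ x₅ → Equation (φ m) (φ x) (φ x₁) (φ x₃) (φ x₅)
    φ-equation {m} {x} {x₁} {x₃} {x₅} e = begin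
      φ x₁ + φ x₃ + b * φ x₅         ≡⟨ cong₂ _+_ (φ-+ x₁ x₃) (trans (φ-* b x₅) (cong (_* φ x₅) φb≡b)) ⟨
      φ (x₁ + x₃) + φ (b * x₅)       ≡⟨ φ-+ _ _ ⟨
      φ (x₁ + x₃ + b * x₅)           ≡⟨ cong φ e ⟩
      φ (m * x)                      ≡⟨ φ-* m x ⟩
      φ m * φ x                      ∎

    -- Indices are modulo 6.
    module Conjugates {m x : Carrier} (g[x]≡mx : g x ≡ m * x) where
      x₁ = φ x
      x₂ = φ x₁
      x₃ = φ x₂
      x₄ = φ x₃
      x₅ = φ x₄
      m₁ = φ m
      m₂ = φ m₁
      m₃ = φ m₂
      m₄ = φ m₃
      m₅ = φ m₄

      e₀ : Equation m x x₁ x₃ x₅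
      e₀ = g[x]≡mx

      e₁ : Equation m₁ x₁ x₂ x₄ x
      e₁ = subst (Equation m₁ x₁ x₂ x₄) (φ⁶≡id x) (φ-equation e₀)

      e₂ : Equation m₂ x₂ x₃ x₅ x₁
      e₂ = φ-equation e₁

      e₃ : Equation m₃ x₃ x₄ x x₂
      e₃ = subst (λ y → Equation m₃ x₃ x₄ y x₂) (φ⁶≡id x) (φ-equation e₂)

      e₄ : Equation m₄ x₄ x₅ x₁ x₃
      e₄ = φ-equation e₃

      e₅ : Equation m₅ x₅ x x₂ x₄
      e₅ = subst (λ y → Equation m₅ x₅ y x₂ x₄) (φ⁶≡id x) (φ-equation e₄)

      -- `row₀` and `row₂` are relations between x, `x₂` and `x₄`. Their third conjugates `row₃` and
      -- `row₅` relate `x₃`, `x₅` and `x₁`.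
      row₀ = row e₀ e₁ e₂ e₄
      row₂ = row e₂ e₃ e₄ e₀
      row₃ = row e₃ e₄ e₅ e₁
      row₅ = row e₅ e₀ e₁ e₃

    -- This is the case m = 0: inverting the circulant system then gives φ x = 0.
    g-kernel-trivial : ∀ {x} → g x ≡ 0# → x ≡ 0#
    g-kernel-trivial {x} gx≡0 = φ-injective (begin
      φ x                                                                 ≡⟨ solve-circulant e₀ e₂ e₄ ⟩
      0# * x + - ((1# + b) * (φ (φ 0#) * x₂)) + φ (φ (φ (φ 0#))) * x₄     ≡⟨ cong₂ (λ u v → 0# * x + - ((1# + b) * (u * x₂)) + v * x₄) φ²0 (trans (cong (λ z → φ (φ z)) φ²0) φ²0) ⟩
      0# * x + - ((1# + b) * (0# * x₂)) + 0# * x₄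
        ≡⟨ solve 4 (λ b x x₂ x₄ → con 0ℤ :* x :- (con 1ℤ :+ b) :* (con 0ℤ :* x₂) :+ con 0ℤ :* x₄ := con 0ℤ) refl b x x₂ x₄ ⟩
      0#                                                                  ≡⟨ φ0≡0 ⟨
      φ 0#                                                                ∎)
      where
      open Conjugates {0#} {x} (trans gx≡0 (sym (zeroˡ x)))
      φ²0 : φ (φ 0#) ≡ 0#
      φ²0 = trans (cong φ φ0≡0) φ0≡0

    -- The hypothesis says that y / x is not fixed by the square of `φ`. It makes (x, x₂, x₄) and
    -- (y, y₂, y₄) independent, so any two rows that annihilate both are proportional.
    module _ {m x y : Carrier} (xy₂-x₂y≢0 : x * φ (φ y) + - (φ (φ x) * y) ≢ 0#)
      (g[x]≡mx : g x ≡ m * x) (g[y]≡my : g y ≡ m * y)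
      where
      private
        module X = Conjugates g[x]≡mx
        module Y = Conjugates g[y]≡my
        open X using (m₁; m₂; m₃; m₄; m₅)
        -- The inverse of 1 - b: (b + 2)(1 - b) = 2 - b - b² = 1.
        γ = b + (1# + 1#)
        rotate : ∀ {x y z} → x + y + z ≡ 0# → z + x + y ≡ 0#
        rotate {x} {y} {z} eq = trans (trans (+-assoc z x y) (+-comm z _)) eq

      minor₁₂ : (b + - (m * m₁)) * (b + - (m₂ * m₃)) + - ((1# + (1# + b) * (m₁ * m₂)) * (1# + - (m₃ * m))) ≡ 0#
      minor₁₂ = minor₁₂≡0 xy₂-x₂y≢0 X.row₀ Y.row₀ (rotate X.row₂) (rotate Y.row₂)

      minor₁₃ : (b + - (m * m₁)) * (1# + (1# + b) * (m₃ * m₄)) + - ((1# + - (m₁ * m₄)) * (1# + - (m₃ * m))) ≡ 0#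
      minor₁₃ = minor₁₃≡0 xy₂-x₂y≢0 X.row₀ Y.row₀ (rotate X.row₂) (rotate Y.row₂)

      -- The third conjugate of `minor₁₃`. The determinant it needs is the image of the given one
      -- under the cube of `φ`.
      minor₁₃′ : (b + - (m₃ * m₄)) * (1# + (1# + b) * (m * m₁)) + - ((1# + - (m₄ * m₁)) * (1# + - (m * m₃))) ≡ 0#
      minor₁₃′ = minor₁₃≡0 φ³≢0 X.row₃ Y.row₃ (rotate X.row₅) (rotate Y.row₅)
        where
        φ-neg : ∀ z → φ (- z) ≡ - φ z
        φ-neg z = +-cancelˡ (φ z) _ _ (trans (sym (φ-+ z (- z)))
          (trans (cong φ (-‿inverseʳ z)) (trans φ0≡0 (sym (-‿inverseʳ (φ z))))))
        φ-det : ∀ x y z w → φ (x * y + - (z * w)) ≡ φ x * φ y + - (φ z * φ w)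
        φ-det x y z w = trans (φ-+ _ _) (cong₂ _+_ (φ-* x y) (trans (φ-neg _) (cong -_ (φ-* z w))))
        φ³≢0 : X.x₃ * Y.x₅ + - (X.x₅ * Y.x₃) ≢ 0#
        φ³≢0 = subst (_≢ 0#)
          (trans (cong (λ z → φ (φ z)) (φ-det _ _ _ _)) (trans (cong φ (φ-det _ _ _ _)) (φ-det _ _ _ _)))
          (φ≢0 (φ≢0 (φ≢0 xy₂-x₂y≢0)))

      -- The products of the last two factors cancel in `minor₁₃` minus `minor₁₃′`. What remains is
      -- (1 + b + b²)(m₃ m₄ - m m₁), and 1 + b + b² = 2.
      mm₁≡m₃m₄ : m₃ * m₄ ≡ m * m₁
      mm₁≡m₃m₄ = x-y≡0⇒x≡y (x≢0∧x*y≡0⇒y≡0 2≢0 (trans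
        (solve 5 (λ b m m₁ m₃ m₄ →
            (con 1ℤ :+ con 1ℤ) :* (m₃ :* m₄ :- m :* m₁)
            := con 1ℤ :* ((b :- m :* m₁) :* (con 1ℤ :+ (con 1ℤ :+ b) :* (m₃ :* m₄)) :- (con 1ℤ :- m₁ :* m₄) :* (con 1ℤ :- m₃ :* m))
               :+ (:- con 1ℤ) :* ((b :- m₃ :* m₄) :* (con 1ℤ :+ (con 1ℤ :+ b) :* (m :* m₁)) :- (con 1ℤ :- m₄ :* m₁) :* (con 1ℤ :- m :* m₃))
               :+ (m :* m₁ :- m₃ :* m₄) :* (b :* b :+ b :- con 1ℤ))
          refl b m m₁ m₃ m₄)
        (1# ⊠ minor₁₃ ⊞ (- 1#) ⊠ minor₁₃′ ⊞ (m * m₁ + - (m₃ * m₄)) ⊠ b²+b-1≡0)))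

      γ≡⇒≡1-b : ∀ {n} → γ * n ≡ 1# → n ≡ 1# + - b
      γ≡⇒≡1-b {n} γn≡1 = x-y≡0⇒x≡y (trans
        (solve 2 (λ b n → n :- (con 1ℤ :- b)
            := (con 1ℤ :- b) :* ((b :+ (con 1ℤ :+ con 1ℤ)) :* n :- con 1ℤ) :+ n :* (b :* b :+ b :- con 1ℤ))
          refl b n)
        ((1# + - b) ⊠ x≡y⇒x-y≡0 γn≡1 ⊞ n ⊠ b²+b-1≡0))

      φγ≡γ : φ γ ≡ γ
      φγ≡γ = trans (φ-+ _ _) (cong₂ _+_ φb≡b (trans (φ-+ _ _) (cong₂ _+_ φ1≡1 φ1≡1)))

      γ-conjugate : ∀ {u v} → γ * (u * v) ≡ 1# → γ * (φ u * φ v) ≡ 1#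
      γ-conjugate {u} {v} eq = begin
        γ * (φ u * φ v)      ≡⟨ cong₂ _*_ φγ≡γ (φ-* u v) ⟨
        φ γ * φ (u * v)      ≡⟨ φ-* _ _ ⟨
        φ (γ * (u * v))      ≡⟨ cong φ eq ⟩
        φ 1#                 ≡⟨ φ1≡1 ⟩
        1#                   ∎

      -- Both (m m₁)(m₃ m₄) and (m m₃)(m₁ m₄) are the product of the same four conjugates. Once m m₁
      -- = m₃ m₄, this makes `minor₁₃` times `- γ` split into two factors.
      γ-alternative : γ * (m * m₃) + - 1# ≡ 0# ⊎ γ * (m₁ * m₄) + - 1# ≡ 0#
      γ-alternative = x*y≡0⇒x≡0∨y≡0 (trans
        (solve 5 (λ b m m₁ m₃ m₄ →
            ((b :+ (con 1ℤ :+ con 1ℤ)) :* (m :* m₃) :- con 1ℤ) :* ((b :+ (con 1ℤ :+ con 1ℤ)) :* (m₁ :* m₄) :- con 1ℤ)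
            := (:- (b :+ (con 1ℤ :+ con 1ℤ))) :* ((b :- m :* m₁) :* (con 1ℤ :+ (con 1ℤ :+ b) :* (m₃ :* m₄)) :- (con 1ℤ :- m₁ :* m₄) :* (con 1ℤ :- m₃ :* m))
               :+ (b :+ (con 1ℤ :+ con 1ℤ)) :* (m₃ :* m₄ :- m :* m₁)
               :+ (con 1ℤ :+ (b :+ (con 1ℤ :+ con 1ℤ)) :* (m₃ :* m₄)) :* (b :* b :+ b :- con 1ℤ))
          refl b m m₁ m₃ m₄)
        ((- γ) ⊠ minor₁₃ ⊞ γ ⊠ x≡y⇒x-y≡0 mm₁≡m₃m₄ ⊞ (1# + γ * (m₃ * m₄)) ⊠ b²+b-1≡0))

      γmm₃≡1 : γ * (m * m₃) ≡ 1#
      -- Conjugating the second alternative twice turns m₁ m₄ into m₃ m, because the sixth conjugate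
      -- of m is m.
      γmm₃≡1 = [ x-y≡0⇒x≡y , (λ eq → trans (cong (γ *_) (*-comm m m₃))
        (subst (λ z → γ * (m₃ * z) ≡ 1#) (φ⁶≡id m) (γ-conjugate (γ-conjugate (x-y≡0⇒x≡y eq))))) ]′ γ-alternative

      mm₃≡1-b : m * m₃ ≡ 1# + - b
      mm₃≡1-b = γ≡⇒≡1-b γmm₃≡1

      m₁m₄≡1-b : m₁ * m₄ ≡ 1# + - b
      m₁m₄≡1-b = γ≡⇒≡1-b (γ-conjugate γmm₃≡1)

      φn≡n : φ (1# + - b) ≡ 1# + - b
      φn≡n = trans (cong φ (sym mm₃≡1-b)) (trans (φ-* m m₃) m₁m₄≡1-b)

      n≢0 : 1# + - b ≢ 0#
      n≢0 n≡0 = 1≢0 (trans (sym γmm₃≡1) (trans (cong (γ *_) (trans mm₃≡1-b n≡0)) (zeroʳ γ)))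

      -- Conjugation would make m₁ m₂ and m₂ m₃ equal to 1 - b as well, and `minor₁₂` would reduce
      -- to 4 - 8b = 0, hence 2b = 1. This contradicts 4(b² + b - 1) = (2b + 3)(2b - 1) - 1.
      mm₁≢n : m * m₁ ≢ 1# + - b
      mm₁≢n eq = 1≢0 (trans
        (solve 1 (λ b → con 1ℤ := (:- (b :+ b :+ con 1ℤ :+ con 1ℤ :+ con 1ℤ)) :* (con 1ℤ :- (b :+ b))
            :+ (:- (con 1ℤ :+ con 1ℤ :+ con 1ℤ :+ con 1ℤ)) :* (b :* b :+ b :- con 1ℤ)) refl b)
        ((- (b + b + 1# + 1# + 1#)) ⊠ x≢0∧x*y≡0⇒y≡0 2≢0 (x≢0∧x*y≡0⇒y≡0 2≢0 4-8b≡0) ⊞ (- (1# + 1# + 1# + 1#)) ⊠ b²+b-1≡0))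
        where
        conjugate : ∀ {u v} → u * v ≡ 1# + - b → φ u * φ v ≡ 1# + - b
        conjugate eq = trans (sym (φ-* _ _)) (trans (cong φ eq) φn≡n)
        minor : (b + - (1# + - b)) * (b + - (1# + - b)) + - ((1# + (1# + b) * (1# + - b)) * (1# + - (1# + - b))) ≡ 0#
        minor = trans (cong₂ (λ u v → u + - v)
            (cong₂ (λ u v → (b + - u) * (b + - v)) (sym eq) (sym (conjugate (conjugate eq))))
            (cong₂ (λ u v → (1# + (1# + b) * u) * (1# + - v)) (sym (conjugate eq)) (trans (sym mm₃≡1-b) (*-comm m m₃))))
          minor₁₂
        4-8b≡0 : (1# + 1#) * ((1# + 1#) * (1# + - (b + b))) ≡ 0#
        4-8b≡0 = trans
          (solve 1 (λ b → (con 1ℤ :+ con 1ℤ) :* ((con 1ℤ :+ con 1ℤ) :* (con 1ℤ :- (b :+ b)))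
              := con 1ℤ :* ((b :- (con 1ℤ :- b)) :* (b :- (con 1ℤ :- b)) :- (con 1ℤ :+ (con 1ℤ :+ b) :* (con 1ℤ :- b)) :* (con 1ℤ :- (con 1ℤ :- b)))
                 :+ (:- (b :+ con 1ℤ :+ con 1ℤ :+ con 1ℤ)) :* (b :* b :+ b :- con 1ℤ)) refl b)
          (1# ⊠ minor ⊞ (- (b + 1# + 1# + 1#)) ⊠ b²+b-1≡0)

      -- With n = 1 - b, conjugation would give m m₁ = m₁ m₂ = m₂ m₃ = -n. Then m m₁ m₂ m₃ is n²
      -- when grouped as (m m₁)(m₂ m₃), but -n² when grouped as (m m₃)(m₁ m₂), so 2n² = 0.
      mm₁+n≢0 : m * m₁ + (1# + - b) ≢ 0#
      mm₁+n≢0 eq = x*y≢0 2≢0 (x*y≢0 n≢0 n≢0) (trans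
        (solve 5 (λ n m m₁ m₂ m₃ →
            (con 1ℤ :+ con 1ℤ) :* (n :* n)
            := (:- (m₂ :* m₃)) :* (m :* m₁ :+ n) :+ n :* (m₂ :* m₃ :+ n) :+ m₁ :* m₂ :* (m :* m₃ :- n) :+ n :* (m₁ :* m₂ :+ n))
          refl (1# + - b) m m₁ m₂ m₃)
        ((- (m₂ * m₃)) ⊠ eq ⊞ (1# + - b) ⊠ conjugate (conjugate eq) ⊞ (m₁ * m₂) ⊠ x≡y⇒x-y≡0 mm₃≡1-b ⊞ (1# + - b) ⊠ conjugate eq))
        where
        conjugate : ∀ {u v} → u * v + (1# + - b) ≡ 0# → φ u * φ v + (1# + - b) ≡ 0#
        conjugate eq = trans (sym (trans (φ-+ _ _) (cong₂ _+_ (φ-* _ _) φn≡n))) (trans (cong φ eq) φ0≡0)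

      -- The square of m m₁ is (m m₁)(m₃ m₄) = (m m₃)(m₁ m₄) = (1 - b)², so m m₁ is 1 - b or its
      -- negative, and both are excluded.
      dependent-conjugates : ⊥
      dependent-conjugates = [ mm₁≢n ∘ x-y≡0⇒x≡y , mm₁+n≢0 ]′ (x*y≡0⇒x≡0∨y≡0 (trans
        (solve 5 (λ n m m₁ m₃ m₄ →
            (m :* m₁ :- n) :* (m :* m₁ :+ n)
            := (:- (m :* m₁)) :* (m₃ :* m₄ :- m :* m₁) :+ m₁ :* m₄ :* (m :* m₃ :- n) :+ n :* (m₁ :* m₄ :- n))
          refl (1# + - b) m m₁ m₃ m₄)
        ((- (m * m₁)) ⊠ x≡y⇒x-y≡0 mm₁≡m₃m₄ ⊞ (m₁ * m₄) ⊠ x≡y⇒x-y≡0 mm₃≡1-b ⊞ (1# + - b) ⊠ x≡y⇒x-y≡0 m₁m₄≡1-b)))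

    g-* : ∀ {t} → φ t ≡ t → ∀ x → g (t * x) ≡ t * g x
    g-* {t} φt≡t x = begin
      g (t * x)
        ≡⟨ cong₂ _+_ (cong₂ _+_ φ-tx (φ²-tx φ-tx)) (cong (b *_) (φ²-tx (φ²-tx φ-tx))) ⟩
      t * φ x + t * φ (φ (φ x)) + b * (t * φ (φ (φ (φ (φ x)))))
        ≡⟨ solve 5 (λ t b u v w → t :* u :+ t :* v :+ b :* (t :* w) := t :* (u :+ v :+ b :* w)) refl t b _ _ _ ⟩
      t * g x ∎
      where
      step : ∀ {u v} → u ≡ t * v → φ u ≡ t * φ v
      step refl = trans (φ-* t _) (cong (_* _) φt≡t)
      φ-tx : φ (t * x) ≡ t * φ x
      φ-tx = step refl
      φ²-tx : ∀ {u v} → u ≡ t * v → φ (φ u) ≡ t * φ (φ v)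
      φ²-tx = step ∘ step

    -- With m = g x / x, both x and t x solve g z = m z. If the square of `φ` moves t, the two
    -- solutions are independent in the sense excluded above. If only `φ` moves t, the kernel of g
    -- is violated.
    ratio-fixed : ∀ {t x} → x ≢ 0# → x * g (t * x) ≡ t * x * g x → φ t ≡ t
    ratio-fixed {t} {x} x≢0 eq with φ t ≟ t | φ (φ t) ≟ t
    ... | yes φt≡t | _         = φt≡t
    ... | no  φt≢t | yes φφt≡t = contradiction (g-kernel-trivial gx≡0) x≢0
      where
      step : ∀ {u v} → u ≡ φ t * v → φ (φ u) ≡ φ t * φ (φ v)
      step {v = v} refl = trans (cong φ (φ-* _ _)) (trans (φ-* _ _) (cong (λ z → φ z * φ (φ v)) φφt≡t))
      -- Only odd powers of `φ` occur in g, and each of them sends t to `φ t`.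
      g[tx] : g (t * x) ≡ φ t * g x
      g[tx] = trans (cong₂ _+_ (cong₂ _+_ (φ-* t x) (step (φ-* t x))) (cong (b *_) (step (step (φ-* t x)))))
        (solve 5 (λ t b u v w → t :* u :+ t :* v :+ b :* (t :* w) := t :* (u :+ v :+ b :* w)) refl (φ t) b _ _ _)
      gx≡0 : g x ≡ 0#
      gx≡0 = x≢0∧x*y≡0⇒y≡0 (φt≢t ∘ x-y≡0⇒x≡y) (x≢0∧x*y≡0⇒y≡0 x≢0 (trans
        (solve 4 (λ x t t₁ u → x :* ((t₁ :- t) :* u) := x :* (t₁ :* u) :- t :* x :* u) refl x t (φ t) (g x))
        (x≡y⇒x-y≡0 (trans (cong (x *_) (sym g[tx])) eq))))
    ... | no  _    | no φφt≢t with x⁻¹ , xx⁻¹≡1 ← inverse x x≢0 =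
      ⊥-elim (dependent-conjugates independent g[x]≡mx g[tx]≡mtx)
      where
      m = x⁻¹ * g x
      g[x]≡mx : g x ≡ m * x
      g[x]≡mx = begin
        g x                  ≡⟨ *-identityˡ _ ⟨
        1# * g x             ≡⟨ cong (_* g x) xx⁻¹≡1 ⟨
        x * x⁻¹ * g x        ≡⟨ solve 3 (λ x u y → x :* u :* y := u :* y :* x) refl x x⁻¹ (g x) ⟩
        m * x                ∎
      g[tx]≡mtx : g (t * x) ≡ m * (t * x)
      g[tx]≡mtx = *-cancelˡ-nonzero x≢0 (begin
        x * g (t * x)          ≡⟨ eq ⟩
        t * x * g x            ≡⟨ cong (t * x *_) g[x]≡mx ⟩
        t * x * (m * x)        ≡⟨ solve 3 (λ t x m → t :* x :* (m :* x) := x :* (m :* (t :* x))) refl t x m ⟩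
        x * (m * (t * x))      ∎)
      independent : x * φ (φ (t * x)) + - (φ (φ x) * (t * x)) ≢ 0#
      independent det≡0 = x*y≢0 (x*y≢0 x≢0 (φ≢0 (φ≢0 x≢0))) (φφt≢t ∘ x-y≡0⇒x≡y) (trans
        (solve 4 (λ x x₂ t t₂ → x :* x₂ :* (t₂ :- t) := x :* (t₂ :* x₂) :- x₂ :* (t :* x)) refl x (φ (φ x)) t (φ (φ t)))
        (trans (cong (λ z → x * z + - (φ (φ x) * (t * x))) (sym (trans (cong φ (φ-* t x)) (φ-* (φ t) (φ x))))) det≡0))

-- Counting decidable subsets of a finite set.

record Enumeration {N : ℕ} (P : Fin N → Set) (n : ℕ) : Set where
  field
    element   : Fin n → Fin N
    injective : Injective _≡_ _≡_ element
    sound     : ∀ i → P (element i)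
    complete  : ∀ {j} → P j → ∃ λ i → element i ≡ j

module _ {N : ℕ} {P : Fin (suc N) → Set} {n : ℕ} (E : Enumeration (P ∘ Fin.suc) n) where
  open Enumeration E

  skip-zero : ¬ P Fin.zero → Enumeration P n
  skip-zero ¬P0 = record
    { element   = Fin.suc ∘ element
    ; injective = injective ∘ Fin.suc-injective
    ; sound     = sound
    ; complete  = complete₀ _
    }
    where
    complete₀ : ∀ j → P j → ∃ λ i → Fin.suc (element i) ≡ j
    complete₀ Fin.zero    P0 = contradiction P0 ¬P0
    complete₀ (Fin.suc j) Pj = let i , eq = complete Pj in i , cong Fin.suc eq

  keep-zero : P Fin.zero → Enumeration P (suc n)
  keep-zero P0 = record
    { element   = element₀
    ; injective = injective₀
    ; sound     = λ { Fin.zero → P0 ; (Fin.suc i) → sound i }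
    ; complete  = complete₀ _
    }
    where
    element₀ : Fin (suc n) → Fin (suc N)
    element₀ Fin.zero    = Fin.zero
    element₀ (Fin.suc i) = Fin.suc (element i)
    injective₀ : Injective _≡_ _≡_ element₀
    injective₀ {Fin.zero}  {Fin.zero}  eq = refl
    injective₀ {Fin.suc i} {Fin.suc j} eq = cong Fin.suc (injective (Fin.suc-injective eq))
    complete₀ : ∀ j → P j → ∃ λ i → element₀ i ≡ j
    complete₀ Fin.zero    P0 = Fin.zero , refl
    complete₀ (Fin.suc j) Pj = let i , eq = complete Pj in Fin.suc i , cong Fin.suc eq

-- The sizes of a subset and its complement add up to N, so upper bounds for both that also add up
-- to N must be attained.
partition : ∀ {N} {P : Fin N → Set} → Decidable P →
            ∃₂ λ m n → m ℕ.+ n ≡ N × Enumeration P m × Enumeration (¬_ ∘ P) n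
partition {zero} P? = 0 , 0 , refl , empty , empty
  where
  empty : ∀ {P : Fin 0 → Set} → Enumeration P 0
  empty = record { element = id ; injective = id ; sound = λ () ; complete = λ { {()} } }
partition {suc N} P? with P? Fin.zero | partition (P? ∘ Fin.suc)
... | yes P0 | m , n , refl , E , F = suc m , n , refl , keep-zero E P0 , skip-zero F (λ ¬P0 → ¬P0 P0)
... | no ¬P0 | m , n , refl , E , F = m , suc n , ℕ.+-suc m n , skip-zero E ¬P0 , keep-zero F ¬P0

-- The fixed field of x ↦ x^q has exactly q elements.

-- q = 1 + s; the cofactor of x^q - x in x^(q^6) - x is the sum of x^(s j) for 0 ≤ j ≤ cofactorTerms s.
cofactorTerms : ℕ → ℕ
cofactorTerms s = let q = suc s in q ℕ.+ q ℕ.^ 2 ℕ.+ q ℕ.^ 3 ℕ.+ q ℕ.^ 4 ℕ.+ q ℕ.^ 5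

-- Multiplying the geometric sum by q - 1 telescopes it to q⁶ - q.
q+degree≡q⁶ : ∀ s → suc s ℕ.+ cofactorTerms s ℕ.* s ≡ suc s ℕ.^ 6
q+degree≡q⁶ = solve 1 (λ s → let q = con 1 :+ s in
    q :+ (q :+ q :^ 2 :+ q :^ 3 :+ q :^ 4 :+ q :^ 5) :* s := q :^ 6) refl
  where open +-*-Solver

module FixedField {N s : ℕ} (1<q : 1 ℕ.< suc s) (N≡q⁶ : N ≡ suc s ℕ.^ 6) (K : FiniteField N) where
  open FiniteField K
  open Field K
  open FieldExtension K (suc s) using (InFq)
  open Inverse enumeration using (to; from; strictlyInverseʳ)
  open ≡.≡-Reasoning

  q : ℕ
  q = suc s

  0<s : 0 ℕ.< s
  0<s = ℕ.≤-pred 1<q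

  cofactor : ℕ → Carrier → Carrier
  cofactor zero    x = 1#
  cofactor (suc m) x = x ^ s * cofactor m x + 1#

  monic-cofactor : ∀ m → Monic (m ℕ.* s) (cofactor m)
  monic-cofactor zero    = λ _ → refl
  monic-cofactor (suc m) = monic-+c 1# (ℕ.≤-trans 0<s (ℕ.m≤m+n s _)) (monic-x*ᵏ s (monic-cofactor m))

  [xˢ-1]*cofactor : ∀ m x → (x ^ s + - 1#) * cofactor m x ≡ x ^ (suc m ℕ.* s) + - 1#
  [xˢ-1]*cofactor zero    x = trans (*-identityʳ _) (cong (λ k → x ^ k + - 1#) (sym (ℕ.+-identityʳ s)))
  [xˢ-1]*cofactor (suc m) x = begin
    (x ^ s + - 1#) * (x ^ s * cofactor m x + 1#)
      ≡⟨ solve 2 (λ y c → (y :- con 1ℤ) :* (y :* c :+ con 1ℤ) := y :* ((y :- con 1ℤ) :* c) :+ (y :- con 1ℤ)) refl (x ^ s) (cofactor m x) ⟩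
    x ^ s * ((x ^ s + - 1#) * cofactor m x) + (x ^ s + - 1#)
      ≡⟨ cong (λ c → x ^ s * c + (x ^ s + - 1#)) ([xˢ-1]*cofactor m x) ⟩
    x ^ s * (x ^ (suc m ℕ.* s) + - 1#) + (x ^ s + - 1#)
      ≡⟨ solve 2 (λ y c → y :* (c :- con 1ℤ) :+ (y :- con 1ℤ) := y :* c :- con 1ℤ) refl (x ^ s) (x ^ (suc m ℕ.* s)) ⟩
    x ^ s * x ^ (suc m ℕ.* s) + - 1#                  ≡⟨ cong (_+ - 1#) (^-homo-* x s (suc m ℕ.* s)) ⟨
    x ^ (suc (suc m) ℕ.* s) + - 1#                    ∎

  monic-xq-x : Monic q (λ x → x ^ q + - x)
  monic-xq-x = _ , 0# , monic-+c (- 1#) 0<s (monic-x^ s) ,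
    λ x → solve 2 (λ x y → x :* y :- x := x :* (y :- con 1ℤ) :+ con 0ℤ) refl x (x ^ s)

  InFq⊎cofactor≡0 : ∀ M → q ℕ.+ M ℕ.* s ≡ N → ∀ x → x ^ q + - x ≡ 0# ⊎ cofactor M x ≡ 0#
  InFq⊎cofactor≡0 M q+Ms≡N x = x*y≡0⇒x≡0∨y≡0 $ begin
    (x ^ q + - x) * cofactor M x
      ≡⟨ solve 3 (λ x y c → (x :* y :- x) :* c := x :* ((y :- con 1ℤ) :* c)) refl x (x ^ s) (cofactor M x) ⟩
    x * ((x ^ s + - 1#) * cofactor M x)    ≡⟨ cong (x *_) ([xˢ-1]*cofactor M x) ⟩
    x * (x ^ (suc M ℕ.* s) + - 1#)         ≡⟨ solve 2 (λ x y → x :* (y :- con 1ℤ) := x :* y :- x) refl x (x ^ (suc M ℕ.* s)) ⟩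
    -- The extra factor x completes the exponent: 1 + (1 + M) s is q + M s because q = 1 + s.
    x ^ (q ℕ.+ M ℕ.* s) + - x              ≡⟨ x≡y⇒x-y≡0 (trans (cong (x ^_) q+Ms≡N) (x^N≡x x)) ⟩
    0#                                     ∎

  InFq? : (x : Carrier) → Dec (InFq x)
  InFq? x = x ^ q ≟ x

  -- At most q elements are roots of x^q - x and at most N - q are roots of its cofactor. Every
  -- element is one or the other, so the first bound is attained.
  enumerate-Fq : ∀ M → q ℕ.+ M ℕ.* s ≡ N → Enumeration (InFq ∘ from) q
  enumerate-Fq M q+Ms≡N with partition (InFq? ∘ from)
  ... | m , n , m+n≡N , E , F = subst (Enumeration (InFq ∘ from)) (ℕ.≤-antisym m≤q q≤m) E
    where
    module E = Enumeration E
    module F = Enumeration F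
    m≤q : m ℕ.≤ q
    m≤q = roots≤degree monic-xq-x (from ∘ E.element) (E.injective ∘ from-injective) (x≡y⇒x-y≡0 ∘ E.sound)
    n≤Ms : n ℕ.≤ M ℕ.* s
    n≤Ms = roots≤degree (monic-cofactor M) (from ∘ F.element) (F.injective ∘ from-injective)
      (λ i → [ (λ eq → contradiction (x-y≡0⇒x≡y eq) (F.sound i)) , id ]′ (InFq⊎cofactor≡0 M q+Ms≡N _))
    q≤m : q ℕ.≤ m
    q≤m = ℕ.+-cancelʳ-≤ (M ℕ.* s) q m
      (ℕ.≤-trans (ℕ.≤-reflexive (trans q+Ms≡N (sym m+n≡N))) (ℕ.+-monoʳ-≤ m n≤Ms))

  -- Abstract, because unfolding the root counts in unification does not terminate in reasonable time.
  abstract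
    Fq-enumeration : Enumeration (InFq ∘ from) q
    Fq-enumeration = enumerate-Fq (cofactorTerms s) (trans (q+degree≡q⁶ s) (sym N≡q⁶))

  scalar : Fin q → Carrier
  scalar = from ∘ Enumeration.element Fq-enumeration

  scalar-injective : Injective _≡_ _≡_ scalar
  scalar-injective = Enumeration.injective Fq-enumeration ∘ from-injective

  InFq-scalar : ∀ i → InFq (scalar i)
  InFq-scalar = Enumeration.sound Fq-enumeration

  index : ∀ {x} → InFq x → ∃ λ i → scalar i ≡ x
  index {x} x∈Fq with i , eq ← Enumeration.complete Fq-enumeration {to x} (subst InFq (sym (strictlyInverseʳ x)) x∈Fq)
    = i , trans (cong from eq) (strictlyInverseʳ x)

  -- A basis of K over F_q with six elements.

  module Basis (+-^q : ∀ x y → (x + y) ^ q ≡ x ^ q + y ^ q) where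
    open import Algebra.Properties.CommutativeMonoid.Sum +-commutativeMonoid
      using (sum; sum-cong-≗; ∑-distrib-+)
    open import Algebra.Properties.Semiring.Sum semiring using (*-distribˡ-sum)

    InFq-1 : InFq 1#
    InFq-1 = 1^ q

    InFq-0 : InFq 0#
    InFq-0 = zeroˡ _

    InFq-* : ∀ {x y} → InFq x → InFq y → InFq (x * y)
    InFq-* {x} {y} x∈Fq y∈Fq = trans (^-distrib-* x y q) (cong₂ _*_ x∈Fq y∈Fq)

    InFq-+ : ∀ {x y} → InFq x → InFq y → InFq (x + y)
    InFq-+ {x} {y} x∈Fq y∈Fq = trans (+-^q x y) (cong₂ _+_ x∈Fq y∈Fq)

    InFq-neg : ∀ {x} → InFq x → InFq (- x)
    InFq-neg {x} x∈Fq = +-cancelˡ x _ _ (begin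
      x + (- x) ^ q          ≡⟨ cong (_+ (- x) ^ q) x∈Fq ⟨
      x ^ q + (- x) ^ q      ≡⟨ +-^q x (- x) ⟨
      (x + - x) ^ q          ≡⟨ cong (_^ q) (-‿inverseʳ x) ⟩
      0# ^ q                 ≡⟨ InFq-0 ⟩
      0#                     ≡⟨ -‿inverseʳ x ⟨
      x + - x                ∎)

    InFq-inverse : ∀ {x y} → x ≢ 0# → x * y ≡ 1# → InFq x → InFq y
    InFq-inverse {x} {y} x≢0 xy≡1 x∈Fq = *-cancelˡ-nonzero x≢0 (begin
      x * y ^ q          ≡⟨ cong (_* y ^ q) x∈Fq ⟨
      x ^ q * y ^ q      ≡⟨ ^-distrib-* x y q ⟨
      (x * y) ^ q        ≡⟨ cong (_^ q) xy≡1 ⟩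
      1# ^ q             ≡⟨ InFq-1 ⟩
      1#                 ≡⟨ xy≡1 ⟨
      x * y              ∎)

    combination : ∀ {m} → (Fin m → Carrier) → (Fin m → Carrier) → Carrier
    combination a e = sum (λ i → a i * e i)

    Independent : ∀ {m} → (Fin m → Carrier) → Set
    Independent e = ∀ a → (∀ i → InFq (a i)) → combination a e ≡ 0# → ∀ i → a i ≡ 0#

    -- Coordinate vectors are coded by numbers below q^m, which makes membership in a span a finite
    -- search and dimension a matter of counting.
    coordinates : ∀ {m} → Fin (q ℕ.^ m) → Fin m → Carrier
    coordinates k i = scalar (finToFun k i)

    Spans : ∀ {m} → (Fin m → Carrier) → Set
    Spans {m} e = ∀ x → ∃ λ k → combination (coordinates {m} k) e ≡ x

    coordinates-surjective : ∀ {m} (a : Fin m → Carrier) → (∀ i → InFq (a i)) →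
                             ∃ λ k → ∀ i → coordinates {m} k i ≡ a i
    coordinates-surjective {m} a a∈Fq = funToFin code ,
      λ i → trans (cong scalar (Fin.finToFun-funToFin code i)) (proj₂ (index (a∈Fq i)))
      where
      code : Fin m → Fin q
      code i = proj₁ (index (a∈Fq i))

    combination-injective : ∀ {m} {e : Fin m → Carrier} → Independent e →
                            Injective _≡_ _≡_ (λ k → combination (coordinates {m} k) e)
    combination-injective {m} {e} e-ind {k} {l} eq = begin
      k                                   ≡⟨ Fin.funToFin-finToFin {m} {q} k ⟨
      funToFin (finToFun {q} {m} k)       ≡⟨ funToFin-cong (λ i → scalar-injective (x-y≡0⇒x≡y (e-ind difference difference∈Fq difference∙e≡0 i))) ⟩
      funToFin (finToFun {q} {m} l)       ≡⟨ Fin.funToFin-finToFin {m} {q} l ⟩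
      l                                   ∎
      where
      funToFin-cong : ∀ {m n} {f g : Fin m → Fin n} → (∀ i → f i ≡ g i) → funToFin f ≡ funToFin g
      funToFin-cong {zero}  f≗g = refl
      funToFin-cong {suc m} f≗g = cong₂ Fin.combine (f≗g Fin.zero) (funToFin-cong (f≗g ∘ Fin.suc))
      difference : Fin m → Carrier
      difference i = coordinates {m} k i + - coordinates {m} l i
      difference∈Fq : ∀ i → InFq (difference i)
      difference∈Fq i = InFq-+ (InFq-scalar (finToFun k i)) (InFq-neg (InFq-scalar (finToFun l i)))
      difference∙e≡0 : combination difference e ≡ 0#
      difference∙e≡0 = +-cancelˡ (combination (coordinates l) e) _ _ (begin
        combination (coordinates l) e + combination difference e
          ≡⟨ ∑-distrib-+ (λ i → coordinates {m} l i * e i) (λ i → difference i * e i) ⟨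
        sum (λ i → coordinates {m} l i * e i + difference i * e i)
          ≡⟨ sum-cong-≗ (λ i → solve 3 (λ a c e → c :* e :+ (a :- c) :* e := a :* e) refl (coordinates {m} k i) (coordinates {m} l i) (e i)) ⟩
        combination (coordinates k) e                                   ≡⟨ eq ⟩
        combination (coordinates l) e                                   ≡⟨ +-identityʳ _ ⟨
        combination (coordinates l) e + 0#                              ∎)

    -- A relation with nonzero coefficient at x could be solved for x, which would put x in the
    -- span.
    extend : ∀ {m} {e : Fin m → Carrier} → Independent e → ∀ x →
             (∀ k → combination (coordinates {m} k) e ≢ x) → Independent (x ∷ e)
    extend {m} {e} e-ind x x∉span a a∈Fq a∙xe≡0 with a Fin.zero ≟ 0#
    ... | yes a₀≡0 = λ where
      Fin.zero    → a₀≡0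
      (Fin.suc i) → e-ind (a ∘ Fin.suc) (a∈Fq ∘ Fin.suc) (begin
        combination (a ∘ Fin.suc) e                         ≡⟨ solve 2 (λ x s → s := con 0ℤ :* x :+ s) refl x (combination (a ∘ Fin.suc) e) ⟩
        0# * x + combination (a ∘ Fin.suc) e                ≡⟨ cong (λ a₀ → a₀ * x + combination (a ∘ Fin.suc) e) a₀≡0 ⟨
        a Fin.zero * x + combination (a ∘ Fin.suc) e        ≡⟨ a∙xe≡0 ⟩
        0#                                                  ∎) i
    ... | no a₀≢0 = contradiction combination≡x (x∉span k)
      where
      c = proj₁ (inverse (a Fin.zero) a₀≢0)
      a₀c≡1 = proj₂ (inverse (a Fin.zero) a₀≢0)
      -c∈Fq : InFq (- c)
      -c∈Fq = InFq-neg (InFq-inverse a₀≢0 a₀c≡1 (a∈Fq Fin.zero))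
      solution : ∃ λ k → ∀ i → coordinates {m} k i ≡ - c * a (Fin.suc i)
      solution = coordinates-surjective (λ i → - c * a (Fin.suc i)) (λ i → InFq-* -c∈Fq (a∈Fq (Fin.suc i)))
      k = proj₁ solution
      combination≡x : combination (coordinates {m} k) e ≡ x
      combination≡x = begin
        combination (coordinates {m} k) e
          ≡⟨ sum-cong-≗ (λ i → trans (cong (_* e i) (proj₂ solution i)) (*-assoc (- c) (a (Fin.suc i)) (e i))) ⟩
        sum (λ i → - c * (a (Fin.suc i) * e i))             ≡⟨ *-distribˡ-sum (- c) (λ i → a (Fin.suc i) * e i) ⟨
        - c * combination (a ∘ Fin.suc) e
          ≡⟨ solve 4 (λ c a₀ x s → (:- c) :* s := (:- c) :* (a₀ :* x :+ s) :+ (a₀ :* c) :* x) refl c (a Fin.zero) x (combination (a ∘ Fin.suc) e) ⟩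
        - c * (a Fin.zero * x + combination (a ∘ Fin.suc) e) + a Fin.zero * c * x
          ≡⟨ cong₂ (λ u v → - c * u + v * x) a∙xe≡0 a₀c≡1 ⟩
        - c * 0# + 1# * x                                   ≡⟨ solve 2 (λ c x → (:- c) :* con 0ℤ :+ con 1ℤ :* x := x) refl c x ⟩
        x                                                   ∎

    -- Greedy extension: an independent family either spans already or misses some element, which is
    -- then adjoined.
    independent⊎basis : ∀ m → (∃ λ (e : Fin m → Carrier) → Independent e)
                            ⊎ (∃₂ λ n (e : Fin n → Carrier) → Independent e × Spans e)
    independent⊎basis zero    = inj₁ ((λ ()) , λ _ _ _ ())
    independent⊎basis (suc m) with independent⊎basis m
    ... | inj₂ basis       = inj₂ basis
    ... | inj₁ (e , e-ind) with Fin.all? (λ j → Fin.any? (λ k → combination (coordinates {m} k) e ≟ from j))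
    ... | yes spans = inj₂ (m , e , e-ind , λ x → let k , eq = spans (to x) in k , trans eq (strictlyInverseʳ x))
    ... | no ¬spans with j , j∉span ← Fin.¬∀⟶∃¬ N _ (λ j → Fin.any? (λ k → combination (coordinates {m} k) e ≟ from j)) ¬spans
      = inj₁ (from j ∷ e , extend e-ind (from j) (λ k eq → j∉span (k , eq)))

    -- Independence embeds the q^m coordinate vectors into the q⁶ elements of K.
    independent⇒≤6 : ∀ {m} {e : Fin m → Carrier} → Independent e → m ℕ.≤ 6
    independent⇒≤6 {m} e-ind = ℕ.≮⇒≥ λ 6<m → ℕ.<⇒≱ (ℕ.^-monoʳ-< q 1<q 6<m)
      (subst (q ℕ.^ m ℕ.≤_) N≡q⁶ (Fin.injective⇒≤ (combination-injective e-ind ∘ to-injective)))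

    -- Choosing coordinates for each element embeds K into the q^m coordinate vectors.
    spans⇒≥6 : ∀ {m} {e : Fin m → Carrier} → Spans e → 6 ℕ.≤ m
    spans⇒≥6 {m} spans = ℕ.≮⇒≥ λ m<6 → ℕ.<⇒≱ (ℕ.^-monoʳ-< q 1<q m<6)
      (subst (ℕ._≤ q ℕ.^ m) N≡q⁶ (Fin.injective⇒≤ {f = λ j → proj₁ (spans (from j))} λ {i} {j} eq →
        from-injective (trans (sym (proj₂ (spans (from i)))) (trans (cong (λ k → combination (coordinates {m} k) _) eq) (proj₂ (spans (from j)))))))

    basis : ∃ λ (e : Fin 6 → Carrier) → Independent e × Spans e
    -- Seven independent elements are impossible, so the greedy extension has stopped at a basis.
    basis with independent⊎basis 7
    ... | inj₁ (e , e-ind) = contradiction (independent⇒≤6 {e = e} e-ind) (ℕ.<⇒≱ (ℕ.n<1+n 6))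
    ... | inj₂ (n , e , e-ind , spans) with refl ← ℕ.≤-antisym (independent⇒≤6 {e = e} e-ind) (spans⇒≥6 {e = e} spans) = e , e-ind , spans

-- Fifth roots of unity and the roots of X² + X = 1.

^-%-≡1 : ∀ m n → m % 5 ≡ 1 → (m ℕ.^ n) % 5 ≡ 1
^-%-≡1 m zero    m%5≡1 = refl
^-%-≡1 m (suc n) m%5≡1 = trans (%-distribˡ-* m (m ℕ.^ n) 5)
  (cong₂ (λ r s → (r ℕ.* s) % 5) m%5≡1 (^-%-≡1 m n m%5≡1))

q⁶%5≡1 : ∀ q → q % 5 ≡ 1 ⊎ q % 5 ≡ 4 → (q ℕ.^ 6) % 5 ≡ 1
q⁶%5≡1 q q%5 = trans (cong (_% 5) (sym (ℕ.^-*-assoc q 2 3))) (^-%-≡1 (q ℕ.^ 2) 3 q²%5≡1)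
  where
  q²%5≡1 : (q ℕ.^ 2) % 5 ≡ 1
  q²%5≡1 = trans (cong (λ r → (q ℕ.* r) % 5) (ℕ.*-identityʳ q)) (trans (%-distribˡ-* q q 5)
    ([ cong (λ r → (r ℕ.* r) % 5) , cong (λ r → (r ℕ.* r) % 5) ]′ q%5))

∣^⇒∣ : ∀ {p} → Prime p → ∀ m n → p ∣ m ℕ.^ n → p ∣ m
∣^⇒∣ {p} pp m zero p∣1 = contradiction (∣⇒≤ p∣1) (ℕ.<⇒≱ (ℕ.nonTrivial⇒n>1 p {{prime⇒nonTrivial pp}}))
∣^⇒∣ pp m (suc n) p∣ = [ id , ∣^⇒∣ pp m n ]′ (euclidsLemma m (m ℕ.^ n) pp p∣)

module FifthRoots {N : ℕ} (K : FiniteField N) where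
  open FiniteField K
  open Field K
  open ≡.≡-Reasoning

  ^-%5 : ∀ {z} → z ^ 5 ≡ 1# → ∀ n → z ^ n ≡ z ^ (n % 5)
  ^-%5 {z} z⁵≡1 n = begin
    z ^ n                                  ≡⟨ cong (z ^_) (m≡m%n+[m/n]*n n 5) ⟩
    z ^ (n % 5 ℕ.+ n / 5 ℕ.* 5)            ≡⟨ ^-homo-* z (n % 5) _ ⟩
    z ^ (n % 5) * z ^ (n / 5 ℕ.* 5)        ≡⟨ cong (λ k → z ^ (n % 5) * z ^ k) (ℕ.*-comm (n / 5) 5) ⟩
    z ^ (n % 5) * z ^ (5 ℕ.* (n / 5))      ≡⟨ cong (z ^ (n % 5) *_) (^-assocʳ z 5 (n / 5)) ⟨
    z ^ (n % 5) * (z ^ 5) ^ (n / 5)        ≡⟨ cong (λ y → z ^ (n % 5) * y ^ (n / 5)) z⁵≡1 ⟩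
    z ^ (n % 5) * 1# ^ (n / 5)             ≡⟨ cong (z ^ (n % 5) *_) (1^ (n / 5)) ⟩
    z ^ (n % 5) * 1#                       ≡⟨ *-identityʳ _ ⟩
    z ^ (n % 5)                            ∎

  -- With M = (N - 1) / 5, the polynomial Y(Y^M - 1) has degree M + 1 < N, so some y is not a root.
  -- Then z = y^M differs from 1, and its fifth power is y^(N-1) = 1.
  fifth-root : N % 5 ≡ 1 → 1 ℕ.< N → ∃ λ z → z ^ 5 ≡ 1# × z ≢ 1#
  fifth-root N%5≡1 1<N = z , z⁵≡1 , λ z≡1 → yz-y≢0 (begin
      y * (z + - 1#)     ≡⟨ cong (y *_) (x≡y⇒x-y≡0 z≡1) ⟩
      y * 0#             ≡⟨ zeroʳ y ⟩
      0#                 ∎)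
    where
    M = N / 5
    N≡1+M*5 : N ≡ suc (M ℕ.* 5)
    N≡1+M*5 = trans (m≡m%n+[m/n]*n N 5) (cong (ℕ._+ M ℕ.* 5) N%5≡1)
    0<M : 0 ℕ.< M
    0<M = ℕ.n≢0⇒n>0 λ M≡0 → ℕ.<⇒≢ 1<N (sym (trans N≡1+M*5 (cong (λ k → suc (k ℕ.* 5)) M≡0)))
    1+M<N : suc M ℕ.< N
    1+M<N = subst (suc M ℕ.<_) (sym N≡1+M*5) (s≤s (ℕ.m<m*n M 5 {{ℕ.>-nonZero 0<M}} (s≤s (s≤s z≤n))))
    nonroot-y : ∃ λ y → y * (y ^ M + - 1#) ≢ 0#
    nonroot-y = nonroot {suc M} (_ , 0# , monic-+c (- 1#) 0<M (monic-x^ M) , λ _ → sym (+-identityʳ _)) 1+M<N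
    y = proj₁ nonroot-y
    z = y ^ M
    yz-y≢0 = proj₂ nonroot-y
    z⁵≡1 : z ^ 5 ≡ 1#
    z⁵≡1 = trans (^-assocʳ y M 5) (trans (cong (λ k → y ^ ℕ.pred k) (sym N≡1+M*5))
      (x^[N-1]≡1 λ y≡0 → yz-y≢0 (trans (cong (_* (y ^ M + - 1#)) y≡0) (zeroˡ _))))

  -- The roots of X² + X = 1 are ζ + ζ⁻¹ and ζ² + ζ⁻² for a primitive fifth root of unity ζ.
  golden-fifth-root : ∀ {b} → b * b + b ≡ 1# → ∀ {z} → z ^ 5 ≡ 1# → z ≢ 1# →
                      ∃ λ ζ → ζ ^ 5 ≡ 1# × b ≡ ζ + ζ ^ 4
  golden-fifth-root {b} b²+b≡1 {z} z⁵≡1 z≢1 =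
    [ (λ eq → z , z⁵≡1 , x-y≡0⇒x≡y eq)
    , (λ eq → z ^ 2 , z¹⁰≡1 , x-y≡0⇒x≡y (trans (cong (λ u → b + - (z ^ 2 + u)) z⁸≡z³) eq))
    ]′ (x*y≡0⇒x≡0∨y≡0 product≡0)
    where
    z¹⁰≡1 : (z ^ 2) ^ 5 ≡ 1#
    z¹⁰≡1 = trans (^-assocʳ z 2 5) (^-%5 z⁵≡1 10)
    z⁸≡z³ : (z ^ 2) ^ 4 ≡ z ^ 3
    z⁸≡z³ = trans (^-assocʳ z 2 4) (^-%5 z⁵≡1 8)
    Φ₅ : 1# + z + z ^ 2 + z ^ 3 + z ^ 4 ≡ 0#
    Φ₅ = x≢0∧x*y≡0⇒y≡0 (z≢1 ∘ x-y≡0⇒x≡y) (trans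
      (solve 1 (λ z → let z² = z :* (z :* con 1ℤ) ; z³ = z :* z² ; z⁴ = z :* z³ in
          (z :- con 1ℤ) :* (con 1ℤ :+ z :+ z² :+ z³ :+ z⁴) := z :* z⁴ :- con 1ℤ) refl z)
      (x≡y⇒x-y≡0 z⁵≡1))
    -- The polynomial X² + X - 1 factors as (X - (z + z⁴))(X - (z² + z³)), because the sum of the
    -- two roots is -1 by `Φ₅` and so is their product.
    product≡0 : (b + - (z + z ^ 4)) * (b + - (z ^ 2 + z ^ 3)) ≡ 0#
    product≡0 = begin
      (b + - (z + z ^ 4)) * (b + - (z ^ 2 + z ^ 3))
        ≡⟨ solve 2 (λ b z → let z² = z :* (z :* con 1ℤ) ; z³ = z :* z² ; z⁴ = z :* z³ in
            (b :- (z :+ z⁴)) :* (b :- (z² :+ z³))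
            := (b :* b :+ b :- con 1ℤ) :+ (z :* z⁴ :- con 1ℤ) :* (z :+ z²) :+ (con 1ℤ :- b) :* (con 1ℤ :+ z :+ z² :+ z³ :+ z⁴)) refl b z ⟩
      (b * b + b + - 1#) + (z ^ 5 + - 1#) * (z + z ^ 2) + (1# + - b) * (1# + z + z ^ 2 + z ^ 3 + z ^ 4)
        ≡⟨ cong₂ (λ u v → u + (z ^ 5 + - 1#) * (z + z ^ 2) + (1# + - b) * v) (x≡y⇒x-y≡0 b²+b≡1) Φ₅ ⟩
      0# + (z ^ 5 + - 1#) * (z + z ^ 2) + (1# + - b) * 0#
        ≡⟨ cong (λ u → 0# + u * (z + z ^ 2) + (1# + - b) * 0#) (x≡y⇒x-y≡0 z⁵≡1) ⟩
      0# + 0# * (z + z ^ 2) + (1# + - b) * 0#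
        ≡⟨ solve 2 (λ b z → con 0ℤ :+ con 0ℤ :* z :+ (con 1ℤ :- b) :* con 0ℤ := con 0ℤ) refl b (z + z ^ 2) ⟩
      0# ∎

  ζ^16≡ζ : ∀ {ζ} → ζ ^ 5 ≡ 1# → (ζ ^ 4) ^ 4 ≡ ζ
  ζ^16≡ζ {ζ} ζ⁵≡1 = begin
    (ζ ^ 4) ^ 4      ≡⟨ ^-assocʳ ζ 4 4 ⟩
    ζ ^ 16           ≡⟨ ^-%5 ζ⁵≡1 16 ⟩
    ζ * 1#           ≡⟨ *-identityʳ ζ ⟩
    ζ                ∎

  -- Raising to the power q either fixes ζ and ζ⁴ or exchanges them, since ζ¹⁶ = ζ.
  ζ+ζ⁴-fixed : ∀ {q ζ} → (∀ x y → (x + y) ^ q ≡ x ^ q + y ^ q) → ζ ^ q ≡ ζ ⊎ ζ ^ q ≡ ζ ^ 4 → ζ ^ 5 ≡ 1# →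
               (ζ + ζ ^ 4) ^ q ≡ ζ + ζ ^ 4
  ζ+ζ⁴-fixed {q} {ζ} +-^q ζ^q ζ⁵≡1 = begin
    (ζ + ζ ^ 4) ^ q              ≡⟨ +-^q ζ (ζ ^ 4) ⟩
    ζ ^ q + (ζ ^ 4) ^ q          ≡⟨ cong (ζ ^ q +_) (^-assocʳ ζ 4 q) ⟩
    ζ ^ q + ζ ^ (4 ℕ.* q)        ≡⟨ cong (λ n → ζ ^ q + ζ ^ n) (ℕ.*-comm 4 q) ⟩
    ζ ^ q + ζ ^ (q ℕ.* 4)        ≡⟨ cong (ζ ^ q +_) (^-assocʳ ζ q 4) ⟨
    ζ ^ q + (ζ ^ q) ^ 4          ≡⟨ [ cong (λ u → u + u ^ 4) , swap ]′ ζ^q ⟩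
    ζ + ζ ^ 4                    ∎
    where
    swap : ∀ {u} → u ≡ ζ ^ 4 → u + u ^ 4 ≡ ζ + ζ ^ 4
    swap refl = trans (cong (_+_ (ζ ^ 4)) (ζ^16≡ζ ζ⁵≡1)) (+-comm (ζ ^ 4) ζ)

  ^q≡ζ⊎ζ⁴ : ∀ {q ζ} → ζ ^ 5 ≡ 1# → q % 5 ≡ 1 ⊎ q % 5 ≡ 4 → ζ ^ q ≡ ζ ⊎ ζ ^ q ≡ ζ ^ 4
  ^q≡ζ⊎ζ⁴ {q} {ζ} ζ⁵≡1 (inj₁ eq) = inj₁ (trans (^-%5 ζ⁵≡1 q) (trans (cong (ζ ^_) eq) (*-identityʳ ζ)))
  ^q≡ζ⊎ζ⁴ {q} {ζ} ζ⁵≡1 (inj₂ eq) = inj₂ (trans (^-%5 ζ⁵≡1 q) (cong (ζ ^_) eq))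

  golden-fixed : ∀ {q b} → (∀ x y → (x + y) ^ q ≡ x ^ q + y ^ q) → b * b + b ≡ 1# →
                 q % 5 ≡ 1 ⊎ q % 5 ≡ 4 → N % 5 ≡ 1 → 1 ℕ.< N → b ^ q ≡ b
  golden-fixed {q} {b} +-^q b²+b≡1 q%5 N%5≡1 1<N =
    let z , z⁵≡1 , z≢1 = fifth-root N%5≡1 1<N
        ζ , ζ⁵≡1 , b≡ζ+ζ⁴ = golden-fifth-root b²+b≡1 z⁵≡1 z≢1
    in subst (λ b → b ^ q ≡ b) (sym b≡ζ+ζ⁴) (ζ+ζ⁴-fixed {q} +-^q (^q≡ζ⊎ζ⁴ {q} ζ⁵≡1 q%5) ζ⁵≡1)

  -- In characteristic 5 the polynomial X² + X - 1 is (X + 3)².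
  golden-char5 : 1# + (1# + (1# + (1# + (1# + 0#)))) ≡ 0# → ∀ {b} → b * b + b ≡ 1# → b ≡ - (1# + 1# + 1#)
  golden-char5 5≡0 {b} b²+b≡1 = x-y≡0⇒x≡y ([ id , id ]′ (x*y≡0⇒x≡0∨y≡0 (begin
    (b + - - (1# + 1# + 1#)) * (b + - - (1# + 1# + 1#))
      ≡⟨ solve 1 (λ b → let 3# = con 1ℤ :+ con 1ℤ :+ con 1ℤ in
          (b :- (:- 3#)) :* (b :- (:- 3#))
          := (b :* b :+ b :- con 1ℤ)
             :+ (con 1ℤ :+ (con 1ℤ :+ (con 1ℤ :+ (con 1ℤ :+ (con 1ℤ :+ con 0ℤ))))) :* (b :+ (con 1ℤ :+ con 1ℤ))) refl b ⟩
    (b * b + b + - 1#) + (1# + (1# + (1# + (1# + (1# + 0#))))) * (b + (1# + 1#))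
      ≡⟨ cong₂ (λ u v → u + v * (b + (1# + 1#))) (x≡y⇒x-y≡0 b²+b≡1) 5≡0 ⟩
    0# + 0# * (b + (1# + 1#))
      ≡⟨ trans (+-identityˡ _) (zeroˡ _) ⟩
    0# ∎)))

-- Consequences of q being an odd prime power congruent to 0, 1 or -1 modulo 5.

module PrimePower {N q p k : ℕ} (pp : Prime p) (0<k : 0 ℕ.< k) (q≡pᵏ : q ≡ p ℕ.^ k) (N≡q⁶ : N ≡ q ℕ.^ 6) (K : FiniteField N) where
  open FiniteField K
  open Field K
  open FifthRoots K
  open PrimeCharacteristic commutativeSemiring using (∣⇒×≈0)
  open import Algebra.Properties.Semiring.Mult semiring using () renaming (_×_ to _×ℕ_)

  1<q : 1 ℕ.< q
  1<q = subst (1 ℕ.<_) (sym q≡pᵏ) (ℕ.^-monoʳ-< p (ℕ.nonTrivial⇒n>1 p {{prime⇒nonTrivial pp}}) 0<k)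

  1<N : 1 ℕ.< N
  1<N = subst (1 ℕ.<_) (sym N≡q⁶) (ℕ.^-monoʳ-< q 1<q {0} {6} (s≤s z≤n))

  N≡p^[k*6] : N ≡ p ℕ.^ (k ℕ.* 6)
  N≡p^[k*6] = trans (trans N≡q⁶ (cong (ℕ._^ 6) q≡pᵏ)) (ℕ.^-*-assoc p k 6)

  +-^q : ∀ x y → (x + y) ^ q ≡ x ^ q + y ^ q
  +-^q = subst (λ q → ∀ x y → (x + y) ^ q ≡ x ^ q + y ^ q) (sym q≡pᵏ) (^pᵏ-distrib-+ p pp (k ℕ.* 6) N≡p^[k*6] k)

  p≡0 : p ×ℕ 1# ≡ 0#
  p≡0 = p×1≡0 p (k ℕ.* 6) N≡p^[k*6]

  q≡0 : q ×ℕ 1# ≡ 0#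
  q≡0 = ∣⇒×≈0 p≡0 (subst (p ∣_) (sym q≡pᵏ) (p∣p^k 0<k)) 1#
    where
    p∣p^k : ∀ {k} → 0 ℕ.< k → p ∣ p ℕ.^ k
    p∣p^k {suc k} _ = m∣m*n (p ℕ.^ k)

  -- If 2 = 0 then q · 1 = 1 for odd q, but q · 1 = 0 because the characteristic divides q.
  2≢0 : q % 2 ≡ 1 → 1# + 1# ≢ 0#
  2≢0 q%2≡1 2≡0 = 1≢0 (begin
    1#                                   ≡⟨ +-identityʳ 1# ⟨
    1# + 0#                              ≡⟨ cong (_+_ 1#) (∣⇒×≈0 (trans (cong (_+_ 1#) (+-identityʳ 1#)) 2≡0) (divides (q / 2) refl) 1#) ⟨
    (1 ℕ.+ q / 2 ℕ.* 2) ×ℕ 1#            ≡⟨ cong (λ r → (r ℕ.+ q / 2 ℕ.* 2) ×ℕ 1#) q%2≡1 ⟨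
    (q % 2 ℕ.+ q / 2 ℕ.* 2) ×ℕ 1#        ≡⟨ cong (_×ℕ 1#) (m≡m%n+[m/n]*n q 2) ⟨
    q ×ℕ 1#                              ≡⟨ q≡0 ⟩
    0#                                   ∎)
    where open ≡.≡-Reasoning

  -- If 5 divides q, the characteristic is 5. Then b^q satisfies the same quadratic equation as b,
  -- whose only root is -3. Otherwise N is 1 modulo 5 and fifth roots of unity are available.
  b^q≡b : q % 5 ≡ 0 ⊎ q % 5 ≡ 1 ⊎ q % 5 ≡ 4 → ∀ {b} → b * b + b ≡ 1# → b ^ q ≡ b
  b^q≡b (inj₂ q%5)   b²+b≡1 = golden-fixed {q} +-^q b²+b≡1 q%5 (trans (cong (_% 5) N≡q⁶) (q⁶%5≡1 q q%5)) 1<N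
  b^q≡b (inj₁ q%5≡0) {b} b²+b≡1 = trans (golden-char5 5≡0 [b^q]²+b^q≡1) (sym (golden-char5 5≡0 b²+b≡1))
    where
    5≡p : 5 ≡ p
    5≡p = [ (λ ()) , id ]′ (prime⇒irreducible pp (∣^⇒∣ (from-yes (prime? 5)) p k (subst (5 ∣_) q≡pᵏ (m%n≡0⇒n∣m q 5 q%5≡0))))
    5≡0 : 5 ×ℕ 1# ≡ 0#
    5≡0 = trans (cong (_×ℕ 1#) 5≡p) p≡0
    [b^q]²+b^q≡1 : b ^ q * b ^ q + b ^ q ≡ 1#
    [b^q]²+b^q≡1 = trans (cong (_+ b ^ q) (sym (^-distrib-* b b q)))
      (trans (sym (+-^q (b * b) b)) (trans (cong (_^ q) b²+b≡1) (1^ q)))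

-- Graphs of F_q-linear maps on K.

module Graph {N s : ℕ} (1<q : 1 ℕ.< suc s) (N≡q⁶ : N ≡ suc s ℕ.^ 6) (K : FiniteField N)
  (+-^q : ∀ x y → FiniteField._^_ K (FiniteField._+_ K x y) (suc s)
                ≡ FiniteField._+_ K (FiniteField._^_ K x (suc s)) (FiniteField._^_ K y (suc s)))
  (f : FiniteField.Carrier K → FiniteField.Carrier K)
  (f-+ : ∀ x y → f (FiniteField._+_ K x y) ≡ FiniteField._+_ K (f x) (f y))
  (f-* : ∀ {a} → FieldExtension.InFq K (suc s) a → ∀ x → f (FiniteField._*_ K a x) ≡ FiniteField._*_ K a (f x))
  where
  open FiniteField K
  open Field K
  open FixedField 1<q N≡q⁶ K
  open Basis +-^q
  open FieldExtension K (suc s)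

  f0≡0 : f 0# ≡ 0#
  f0≡0 = trans (cong f (sym (zeroˡ 0#))) (trans (f-* InFq-0 0#) (zeroˡ (f 0#)))

  subspace : IsFqSubspace (graph f)
  subspace = (0# , cong (0# ,_) (sym f0≡0))
           , (λ { _ _ (x , refl) (y , refl) → x + y , cong (x + y ,_) (sym (f-+ x y)) })
           , (λ { a _ a∈Fq (x , refl) → a * x , cong (a * x ,_) (sym (f-* a∈Fq x)) })

  lincomb-graph : ∀ n a (e : Fin n → Carrier) → (∀ i → InFq (a i)) →
                  lincomb n a (λ i → e i , f (e i)) ≡ (combination a e , f (combination a e))
  lincomb-graph zero    a e a∈Fq = cong (0# ,_) (sym f0≡0)
  lincomb-graph (suc n) a e a∈Fq = trans (cong (_⊕_ _) (lincomb-graph n (a ∘ Fin.suc) (e ∘ Fin.suc) (a∈Fq ∘ Fin.suc)))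
    (cong (_ ,_) (trans (cong (_+ f (combination (a ∘ Fin.suc) (e ∘ Fin.suc))) (sym (f-* (a∈Fq Fin.zero) (e Fin.zero)))) (sym (f-+ _ _))))

  dimension : HasFqDim (graph f) 6
  dimension with e , e-ind , spans ← basis =
    (λ i → e i , f (e i)) , (λ i → e i , refl) , spanning , independent
    where
    spanning : ∀ u → graph f u → ∃ λ a → (∀ i → InFq (a i)) × u ≡ lincomb 6 a (λ i → e i , f (e i))
    spanning _ (x , refl) with k , refl ← spans x =
      coordinates k , (λ i → InFq-scalar _) , sym (lincomb-graph 6 (coordinates k) e (λ i → InFq-scalar _))
    independent : ∀ a → (∀ i → InFq (a i)) → lincomb 6 a (λ i → e i , f (e i)) ≡ 0V → ∀ i → a i ≡ 0#
    independent a a∈Fq eq = e-ind a a∈Fq (cong proj₁ (trans (sym (lincomb-graph 6 a e a∈Fq)) eq))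

  -- Two vectors (x, f x) and (y, f y) on one line satisfy x f(y) = y f(x). With t = y / x this is
  -- the hypothesis on ratios, and t in F_q makes the second vector t times the first.
  scattered : (∀ {t x} → x ≢ 0# → x * f (t * x) ≡ t * x * f x → InFq t) → IsScattered (graph f)
  scattered ratio∈Fq (v , w) _ _ _ (x , refl) (l , u₁≡lv) (y , refl) (m , u₂≡mv) with x ≟ 0#
  -- Here the first vector is zero, so the coefficients 1 and 0 give a dependence.
  ... | yes refl = 1# , 0# , InFq-1 , InFq-0 , (λ (1≡0 , _) → 1≢0 1≡0) ,
    cong₂ _,_ (solve 1 (λ y → con 1ℤ :* con 0ℤ :+ con 0ℤ :* y := con 0ℤ) refl y)
      (trans (cong (λ z → 1# * z + 0# * f y) f0≡0) (solve 1 (λ y → con 1ℤ :* con 0ℤ :+ con 0ℤ :* y := con 0ℤ) refl (f y)))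
  ... | no x≢0 with x⁻¹ , xx⁻¹≡1 ← inverse x x≢0 =
    t , - 1# , t∈Fq , InFq-neg InFq-1 , (λ (_ , -1≡0) → 1≢0 (trans (solve 0 (con 1ℤ := :- (:- con 1ℤ)) refl) (trans (cong -_ -1≡0) (solve 0 (:- con 0ℤ := con 0ℤ) refl)))) ,
    cong₂ _,_ (trans (cong (_+ - 1# * y) tx≡y) (cancel y))
      (trans (cong (_+ - 1# * f y) (trans (sym (f-* t∈Fq x)) (cong f tx≡y))) (cancel (f y)))
    where
    open ≡.≡-Reasoning
    t = y * x⁻¹
    cancel : ∀ z → z + - 1# * z ≡ 0#
    cancel = solve 1 (λ z → z :+ (:- con 1ℤ) :* z := con 0ℤ) refl
    tx≡y : t * x ≡ y
    tx≡y = trans (*-assoc y x⁻¹ x) (trans (cong (y *_) (trans (*-comm x⁻¹ x) xx⁻¹≡1)) (*-identityʳ y))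
    xfy≡yfx : x * f y ≡ y * f x
    xfy≡yfx = begin
      x * f y                ≡⟨ cong₂ _*_ (cong proj₁ u₁≡lv) (cong proj₂ u₂≡mv) ⟩
      l * v * (m * w)        ≡⟨ solve 4 (λ l v m w → l :* v :* (m :* w) := m :* v :* (l :* w)) refl l v m w ⟩
      m * v * (l * w)        ≡⟨ cong₂ _*_ (cong proj₁ u₂≡mv) (cong proj₂ u₁≡lv) ⟨
      y * f x                ∎
    t∈Fq : InFq t
    t∈Fq = ratio∈Fq x≢0 (trans (cong (λ y → x * f y) tx≡y) (trans xfy≡yfx (cong (_* f x) (sym tx≡y))))

-- The trinomial as an instance of the semilinear argument.

module MaxScattered {N s : ℕ} (1<q : 1 ℕ.< suc s) (N≡q⁶ : N ≡ suc s ℕ.^ 6) (K : FiniteField N)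
  (+-^q : ∀ x y → FiniteField._^_ K (FiniteField._+_ K x y) (suc s)
                ≡ FiniteField._+_ K (FiniteField._^_ K x (suc s)) (FiniteField._^_ K y (suc s)))
  (b : FiniteField.Carrier K)
  (b²+b≡1 : FiniteField._+_ K (FiniteField._*_ K b b) b ≡ FiniteField.1# K)
  (b^q≡b : FiniteField._^_ K b (suc s) ≡ b)
  (2≢0 : FiniteField._+_ K (FiniteField.1# K) (FiniteField.1# K) ≢ FiniteField.0# K)
  where
  open FiniteField K
  open Field K
  open FieldExtension K (suc s) using (IsMaxScattered; graph)
  open ≡.≡-Reasoning

  q : ℕ
  q = suc s

  -- The power x^(q^n) in nested form, which unfolds to the iterates of `φ` that `Semilinear` uses.
  conjugate : ℕ → Carrier → Carrier
  conjugate zero    x = x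
  conjugate (suc n) x = conjugate n (x ^ q)

  ^qⁿ≡conjugate : ∀ n x → x ^ (q ℕ.^ n) ≡ conjugate n x
  ^qⁿ≡conjugate zero    x = *-identityʳ x
  ^qⁿ≡conjugate (suc n) x = trans (sym (^-assocʳ x q (q ℕ.^ n))) (^qⁿ≡conjugate n (x ^ q))

  ^q⁶≡id : ∀ x → conjugate 6 x ≡ x
  ^q⁶≡id x = trans (sym (^qⁿ≡conjugate 6 x)) (trans (cong (x ^_) (sym N≡q⁶)) (x^N≡x x))

  open Trinomial K b b²+b≡1
  open Semilinear (_^ q) +-^q (λ x y → ^-distrib-* x y q) ^q⁶≡id b^q≡b 2≢0

  f : Carrier → Carrier
  f x = x ^ q + x ^ (q ℕ.^ 3) + b * x ^ (q ℕ.^ 5)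

  f≗g : ∀ x → f x ≡ g x
  f≗g x = cong₂ (λ y z → x ^ q + y + b * z) (^qⁿ≡conjugate 3 x) (^qⁿ≡conjugate 5 x)

  conjugate-+ : ∀ n x y → conjugate n (x + y) ≡ conjugate n x + conjugate n y
  conjugate-+ zero    x y = refl
  conjugate-+ (suc n) x y = trans (cong (conjugate n) (+-^q x y)) (conjugate-+ n (x ^ q) (y ^ q))

  f-+ : ∀ x y → f (x + y) ≡ f x + f y
  f-+ x y = begin
    f (x + y)      ≡⟨ f≗g (x + y) ⟩
    g (x + y)      ≡⟨ cong₂ _+_ (cong₂ _+_ (conjugate-+ 1 x y) (conjugate-+ 3 x y)) (cong (b *_) (conjugate-+ 5 x y)) ⟩
    (conjugate 1 x + conjugate 1 y) + (conjugate 3 x + conjugate 3 y) + b * (conjugate 5 x + conjugate 5 y)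
      ≡⟨ solve 7 (λ b u v w u′ v′ w′ → (u :+ u′) :+ (v :+ v′) :+ b :* (w :+ w′) := (u :+ v :+ b :* w) :+ (u′ :+ v′ :+ b :* w′)) refl
           b (conjugate 1 x) (conjugate 3 x) (conjugate 5 x) (conjugate 1 y) (conjugate 3 y) (conjugate 5 y) ⟩
    g x + g y      ≡⟨ cong₂ _+_ (f≗g x) (f≗g y) ⟨
    f x + f y      ∎

  f-* : ∀ {a} → a ^ q ≡ a → ∀ x → f (a * x) ≡ a * f x
  f-* {a} a∈Fq x = trans (f≗g (a * x)) (trans (g-* a∈Fq x) (cong (a *_) (sym (f≗g x))))

  open Graph 1<q N≡q⁶ K +-^q f f-+ f-*

  isMaxScattered : IsMaxScattered 6 (graph f)
  isMaxScattered = subspace , dimension , scattered λ {t} {x} x≢0 eq → ratio-fixed x≢0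
    (trans (cong (x *_) (sym (f≗g (t * x)))) (trans eq (cong (t * x *_) (f≗g x))))

trinomial-isMaxScattered : ∀ {N} q → 1 ℕ.< q → N ≡ q ℕ.^ 6 → (K : FiniteField N) → let open FiniteField K in
  (∀ x y → (x + y) ^ q ≡ x ^ q + y ^ q) → ∀ b → b * b + b ≡ 1# → b ^ q ≡ b → 1# + 1# ≢ 0# →
  FieldExtension.IsMaxScattered K q 6 (FieldExtension.graph K q (λ x → x ^ q + x ^ (q ℕ.^ 3) + b * x ^ (q ℕ.^ 5)))
trinomial-isMaxScattered (suc s) = MaxScattered.isMaxScattered

open import Data.Nat using (ℕ; _^_; _%_)
open import Data.Product using (_×_)
open import Data.Sum using (_⊎_)
open import Relation.Binary.PropositionalEquality using (_≡_)

theorem5p1 : (q : ℕ) → IsPrimePower q → q % 2 ≡ 1 → (q % 5 ≡ 0 ⊎ q % 5 ≡ 1 ⊎ q % 5 ≡ 4) →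
    (K : FiniteField (q ^ 6)) → (b : FiniteField.Carrier K) →
    FiniteField._+_ K (FiniteField._*_ K b b) b ≡ FiniteField.1# K →
    FieldExtension.IsMaxScattered K q 6
    (FieldExtension.graph K q (λ x → FiniteField._+_ K (FiniteField._+_ K (FiniteField._^_ K x q) (FiniteField._^_ K x (q ^ 3))) (FiniteField._*_ K b (FiniteField._^_ K x (q ^ 5)))))
theorem5p1 q (p , k , pp , 0<k , q≡pᵏ) q%2≡1 q%5 K b b²+b≡1 =
  trinomial-isMaxScattered q 1<q refl K +-^q b b²+b≡1 (b^q≡b q%5 b²+b≡1) (2≢0 q%2≡1)
  where open PrimePower pp 0<k q≡pᵏ refl K
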